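{- Let $\{\langle X_i,\tau_i\rangle\}_{i\in I}$ be a family of Stone MV-spaces. Then their product $\langle \prod_{i\in I}X_i,\tau_X\rangle$, where $\tau_X$ is the product MV-topology, is a Stone MV-space.
   Context: On $[0,1]$ put $x\oplus y=\min(x+y,1)$, $x\odot y=\max(x+y-1,0)$, $x^*=1-x$, $x\wedge y=\min(x,y)$; these operations and arbitrary joins $\bigvee$ are extended pointwise to $[0,1]^X$. $\mathbf 0,\mathbf 1$ denote the constant functions $0,1$. An MV-topological space is a pair $\langle X,\tau\rangle$ with $X$ a set and $\tau\subseteq[0,1]^X$ such that $\mathbf 0,\mathbf 1\in\tau$, $\tau$ is closed under arbitrary joins, and $o_1\odot o_2,\ o_1\oplus o_2,\ o_1\wedge o_2\in\tau$ for all $o_1,o_2\in\tau$. Elements of $\tau$ are called open, elements of $\{o^*\mid o\in\tau\}$ closed; clopen means open and closed. A base for $\tau$ is a subset $B\subseteq\tau$ such that every element of $\tau$ is a join of elements of $B$. The space is zero-dimensional if it has a base consisting of clopens. It is Hausdorff if for all $x\neq y$ in $X$ there are $o_x,o_y\in\tau$ with $o_x(x)=o_y(y)=1$ and $o_x\wedge o_y=\mathbf 0$. It is compact if for every $\Gamma\subseteq\tau$ with $\bigvee\Gamma=\mathbf 1$ there is a finite family $(\alpha_k)_{k=1}^n$ of elements of $\Gamma$ (repetitions allowed) with $\alpha_1\oplus\cdots\oplus\alpha_n=\mathbf 1$. A Stone MV-space is an MV-topological space which is compact, Hausdorff and zero-dimensional. Product MV-topology: on $X=\prod_{i\in I}X_i$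 with canonical projections $\pi_i$, $\tau_X$ is the MV-topology with subbase $S=\{\alpha\circ\pi_i\mid i\in I,\ \alpha\in\tau_i\}$, i.e. the smallest MV-topology on $X$ containing $S$ (for $I\neq\varnothing$ its elements are exactly the joins of finite combinations of elements of $S$ by $\oplus,\odot,\wedge$). -}

module Defs where

open import Axiom.ExcludedMiddle using (ExcludedMiddle)
open import Axiom.Extensionality.Propositional using (Extensionality)
open import Level using (Level; Setω; 0ℓ; suc; _⊔_)
open import Data.List.Base using (List; foldr)
open import Data.List.Relation.Unary.All using (All)
open import Data.Product.Base using (Σ; ∃; ∃₂; _×_; _,_; proj₁; proj₂)
open import Data.Rational.Base as ℚ using (ℚ; 0ℚ; 1ℚ)
import Data.Rational.Properties as ℚₚ
open import Data.Sum.Base as Sum using (_⊎_; inj₁; inj₂; [_,_]′)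
open import Function.Base using (_∘_; _∘′_; id)
open import Relation.Binary.Definitions using (tri<; tri≈; tri>)
open import Relation.Binary.PropositionalEquality
  using (_≡_; _≢_; refl; sym; trans; cong; subst)
open import Relation.Nullary.Negation using (¬_; contradiction)
open import Relation.Unary using (Pred; _∈_; _∉_; _⊆_)

------------------------------------------------------------------------
-- Rational arithmetic

private

  -‿+-cancel : ∀ p b → (p ℚ.- b) ℚ.+ b ≡ p
  -‿+-cancel p b = trans (ℚₚ.+-assoc p (ℚ.- b) b)
    (trans (cong (p ℚ.+_) (ℚₚ.+-inverseˡ b)) (ℚₚ.+-identityʳ p))

  +‿-‿cancel : ∀ a b → (a ℚ.+ b) ℚ.- b ≡ a
  +‿-‿cancel a b = trans (ℚₚ.+-assoc a b (ℚ.- b))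
    (trans (cong (a ℚ.+_) (ℚₚ.+-inverseʳ b)) (ℚₚ.+-identityʳ a))

  p-1<p : ∀ p → p ℚ.- 1ℚ ℚ.< p
  p-1<p p = subst (p ℚ.- 1ℚ ℚ.<_) (ℚₚ.+-identityʳ p)
    (ℚₚ.+-monoʳ-< p (ℚₚ.negative⁻¹ (ℚ.- 1ℚ)))

  p<p+1 : ∀ p → p ℚ.< p ℚ.+ 1ℚ
  p<p+1 p = subst (ℚ._< p ℚ.+ 1ℚ) (ℚₚ.+-identityʳ p)
    (ℚₚ.+-monoʳ-< p (ℚₚ.positive⁻¹ 1ℚ))

  neg-cancel-< : ∀ {p q} → ℚ.- p ℚ.< ℚ.- q → q ℚ.< p
  neg-cancel-< h = ℚₚ.≰⇒> λ p≤q → ℚₚ.<-irrefl refl (ℚₚ.<-≤-trans h (ℚₚ.neg-antimono-≤ p≤q))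

------------------------------------------------------------------------
-- Real numbers, as (lower halves of) Dedekind cuts of ℚ.  This is the
-- classical notion: without excluded middle a lower half need not
-- determine a real number, and - below need not be involutive.

record ℝ : Set₁ where
  field
    lower     : Pred ℚ 0ℓ
    inhabited : ∃ λ q → q ∈ lower
    bounded   : ∃ λ q → q ∉ lower
    downward  : ∀ {p q} → p ℚ.< q → q ∈ lower → p ∈ lower
    rounded   : ∀ {q} → q ∈ lower → ∃ λ r → q ℚ.< r × r ∈ lower

  ∈<∉ : ∀ {a u} → a ∈ lower → u ∉ lower → a ℚ.< u
  ∈<∉ {a} {u} a∈ u∉ with ℚₚ.<-cmp a u
  ... | tri< a<u _ _  = a<u
  ... | tri≈ _ refl _ = contradiction a∈ u∉
  ... | tri> _ _ u<a  = contradiction (downward u<a a∈) u∉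

open ℝ using (lower)

infix  4 _≤_ _≈_
infixl 6 _+_ _-_
infix  8 -_

-- Two cuts are identified when they have the same elements.

_≤_ _≈_ : ℝ → ℝ → Set
x ≤ y = lower x ⊆ lower y
x ≈ y = x ≤ y × y ≤ x

fromℚ : ℚ → ℝ
fromℚ r = record
  { lower     = ℚ._< r
  ; inhabited = r ℚ.- 1ℚ , p-1<p r
  ; bounded   = r , ℚₚ.<-irrefl refl
  ; downward  = ℚₚ.<-trans
  ; rounded   = λ q<r → let s , q<s , s<r = ℚₚ.<-dense q<r in s , q<s , s<r
  }

0ᴿ 1ᴿ : ℝ
0ᴿ = fromℚ 0ℚ
1ᴿ = fromℚ 1ℚ

_+_ : ℝ → ℝ → ℝ
x + y = record
  { lower     = λ q → ∃₂ λ a b → a ∈ lower x × b ∈ lower y × q ≡ a ℚ.+ b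
  ; inhabited = let a , a∈ = X.inhabited ; b , b∈ = Y.inhabited in
                a ℚ.+ b , a , b , a∈ , b∈ , refl
  ; bounded   = let u , u∉ = X.bounded ; v , v∉ = Y.bounded in
                u ℚ.+ v , λ (a , b , a∈ , b∈ , eq) →
                  ℚₚ.<-irrefl (sym eq) (ℚₚ.+-mono-< (X.∈<∉ a∈ u∉) (Y.∈<∉ b∈ v∉))
  ; downward  = λ {p} → λ where
      p<q (a , b , a∈ , b∈ , refl) →
        p ℚ.- b , b
        , X.downward (subst (p ℚ.- b ℚ.<_) (+‿-‿cancel a b) (ℚₚ.+-monoˡ-< (ℚ.- b) p<q)) a∈
        , b∈ , sym (-‿+-cancel p b)
  ; rounded   = λ where
      (a , b , a∈ , b∈ , refl) → let a′ , a<a′ , a′∈ = X.rounded a∈ in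
        a′ ℚ.+ b , ℚₚ.+-monoˡ-< b a<a′ , a′ , b , a′∈ , b∈ , refl
  }
  where module X = ℝ x ; module Y = ℝ y

-- The strict inequality discards the endpoint − r of a rational cut, so
-- that the result is again an open lower set.

-_ : ℝ → ℝ
- x = record
  { lower     = λ q → ∃ λ r → r ∉ lower x × q ℚ.< ℚ.- r
  ; inhabited = let u , u∉ = X.bounded in ℚ.- u ℚ.- 1ℚ , u , u∉ , p-1<p (ℚ.- u)
  ; bounded   = let a , a∈ = X.inhabited in
                ℚ.- a , λ (r , r∉ , lt) → r∉ (X.downward (neg-cancel-< lt) a∈)
  ; downward  = λ p<q (r , r∉ , lt) → r , r∉ , ℚₚ.<-trans p<q lt
  ; rounded   = λ (r , r∉ , lt) →
                let s , q<s , s<-r = ℚₚ.<-dense lt in s , q<s , r , r∉ , s<-r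
  }
  where module X = ℝ x

_-_ : ℝ → ℝ → ℝ
x - y = x + - y

min : ℝ → ℝ → ℝ
min x y = record
  { lower     = λ q → q ∈ lower x × q ∈ lower y
  ; inhabited = let a , a∈ = X.inhabited ; b , b∈ = Y.inhabited in
                lowerBound a∈ b∈
  ; bounded   = let u , u∉ = X.bounded in u , u∉ ∘′ proj₁
  ; downward  = λ p<q (q∈x , q∈y) → X.downward p<q q∈x , Y.downward p<q q∈y
  ; rounded   = λ (q∈x , q∈y) →
      let r , q<r , r∈ = X.rounded q∈x ; s , q<s , s∈ = Y.rounded q∈y in
      smaller q<r q<s r∈ s∈
  }
  where
  module X = ℝ x
  module Y = ℝ y

  lowerBound : ∀ {a b} → a ∈ lower x → b ∈ lower y →
               ∃ λ q → q ∈ lower x × q ∈ lower y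
  lowerBound {a} {b} a∈ b∈ with ℚₚ.<-cmp a b
  ... | tri< a<b _ _  = a , a∈ , Y.downward a<b b∈
  ... | tri≈ _ refl _ = a , a∈ , b∈
  ... | tri> _ _ b<a  = b , X.downward b<a a∈ , b∈

  smaller : ∀ {q r s} → q ℚ.< r → q ℚ.< s → r ∈ lower x → s ∈ lower y →
            ∃ λ t → q ℚ.< t × t ∈ lower x × t ∈ lower y
  smaller {q} {r} {s} q<r q<s r∈ s∈ with ℚₚ.<-cmp r s
  ... | tri< r<s _ _  = r , q<r , r∈ , Y.downward r<s s∈
  ... | tri≈ _ refl _ = r , q<r , r∈ , s∈
  ... | tri> _ _ s<r  = s , q<s , X.downward s<r r∈ , s∈

max : ℝ → ℝ → ℝ
max x y = record
  { lower     = λ q → q ∈ lower x ⊎ q ∈ lower y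
  ; inhabited = let a , a∈ = X.inhabited in a , inj₁ a∈
  ; bounded   = let u , u∉ = X.bounded ; v , v∉ = Y.bounded in upperBound u∉ v∉
  ; downward  = λ p<q → Sum.map (X.downward p<q) (Y.downward p<q)
  ; rounded   = λ where
      (inj₁ q∈) → let r , q<r , r∈ = X.rounded q∈ in r , q<r , inj₁ r∈
      (inj₂ q∈) → let r , q<r , r∈ = Y.rounded q∈ in r , q<r , inj₂ r∈
  }
  where
  module X = ℝ x
  module Y = ℝ y

  upperBound : ∀ {u v} → u ∉ lower x → v ∉ lower y →
               ∃ λ q → ¬ (q ∈ lower x ⊎ q ∈ lower y)
  upperBound {u} {v} u∉ v∉ with ℚₚ.<-cmp u v
  ... | tri< u<v _ _  = v , [ u∉ ∘′ X.downward u<v , v∉ ]′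
  ... | tri≈ _ refl _ = u , [ u∉ , v∉ ]′
  ... | tri> _ _ v<u  = u , [ u∉ , v∉ ∘′ Y.downward v<u ]′

------------------------------------------------------------------------
-- The unit interval and its MV-operations

record 𝕀 : Set₁ where
  field
    value : ℝ
    0≤    : 0ᴿ ≤ value
    ≤1    : value ≤ 1ᴿ

open 𝕀 using (value)

infix 4 _≤ᴵ_ _≈ᴵ_

_≤ᴵ_ _≈ᴵ_ : 𝕀 → 𝕀 → Set
x ≤ᴵ y = value x ≤ value y
x ≈ᴵ y = value x ≈ value y

0ᴵ 1ᴵ : 𝕀
0ᴵ = record { value = 0ᴿ ; 0≤ = id ; ≤1 = λ q<0 → ℚₚ.<-trans q<0 (ℚₚ.positive⁻¹ 1ℚ) }
1ᴵ = record { value = 1ᴿ ; 0≤ = λ q<0 → ℚₚ.<-trans q<0 (ℚₚ.positive⁻¹ 1ℚ) ; ≤1 = id }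

private

  0≤+ : ∀ x y → 0ᴿ ≤ x → 0ᴿ ≤ y → 0ᴿ ≤ x + y
  0≤+ x y 0≤x 0≤y {q} q<0 =
    let r , q<r , r<0 = ℚₚ.<-dense q<0 in
    q ℚ.- r , r
    , 0≤x (subst (q ℚ.- r ℚ.<_) (ℚₚ.+-inverseʳ r) (ℚₚ.+-monoˡ-< (ℚ.- r) q<r))
    , 0≤y r<0 , sym (-‿+-cancel q r)

  x+y-1≤1 : ∀ x y → x ≤ 1ᴿ → y ≤ 1ᴿ → x + y - 1ᴿ ≤ 1ᴿ
  x+y-1≤1 x y x≤1 y≤1 (_ , c , (a , b , a∈ , b∈ , refl) , (r , r≮1 , c<-r) , refl) =
    ℚₚ.<-≤-trans
      (ℚₚ.+-mono-< (ℚₚ.+-mono-< (x≤1 a∈) (y≤1 b∈)) c<-r)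
      (ℚₚ.+-monoʳ-≤ (1ℚ ℚ.+ 1ℚ) (ℚₚ.neg-antimono-≤ (ℚₚ.≮⇒≥ r≮1)))

  0≤1-x : ∀ x → x ≤ 1ᴿ → 0ᴿ ≤ 1ᴿ - x
  0≤1-x x x≤1 {q} q<0 =
    let r , q<r , r<0 = ℚₚ.<-dense q<0
        1+r = r ℚ.+ 1ℚ
    in
    1+r , q ℚ.- 1+r
    , ℚₚ.+-monoˡ-< 1ℚ r<0
    , (1ℚ , (λ 1∈ → ℚₚ.<-irrefl refl (x≤1 1∈)) , q-1+r<-1 q<r)
    , sym (trans (ℚₚ.+-comm 1+r (q ℚ.- 1+r)) (-‿+-cancel q 1+r))
    where
    q-1+r<-1 : ∀ {q r} → q ℚ.< r → q ℚ.- (r ℚ.+ 1ℚ) ℚ.< ℚ.- 1ℚ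
    q-1+r<-1 {q} {r} q<r = subst (q ℚ.- (r ℚ.+ 1ℚ) ℚ.<_)
      (trans (cong (r ℚ.+_) (ℚₚ.neg-distrib-+ r 1ℚ))
        (trans (sym (ℚₚ.+-assoc r (ℚ.- r) (ℚ.- 1ℚ)))
          (trans (cong (ℚ._+ ℚ.- 1ℚ) (ℚₚ.+-inverseʳ r)) (ℚₚ.+-identityˡ (ℚ.- 1ℚ)))))
      (ℚₚ.+-monoˡ-< (ℚ.- (r ℚ.+ 1ℚ)) q<r)

  1-x≤1 : ∀ x → 0ᴿ ≤ x → 1ᴿ - x ≤ 1ᴿ
  1-x≤1 x 0≤x (a , c , a<1 , (r , r∉ , c<-r) , refl) =
    ℚₚ.+-mono-< a<1
      (ℚₚ.<-≤-trans c<-r (ℚₚ.neg-antimono-≤ (ℚₚ.≮⇒≥ (r∉ ∘′ 0≤x))))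

infixl 6 _⊕_
infixl 7 _⊙_ _∧_
infix  8 _*

_⊕_ _⊙_ _∧_ : 𝕀 → 𝕀 → 𝕀
x ⊕ y = record
  { value = min (value x + value y) 1ᴿ
  ; 0≤    = λ q<0 → 0≤+ (value x) (value y) (𝕀.0≤ x) (𝕀.0≤ y) q<0 , 𝕀.0≤ 1ᴵ q<0
  ; ≤1    = proj₂
  }
x ⊙ y = record
  { value = max (value x + value y - 1ᴿ) 0ᴿ
  ; 0≤    = inj₂
  ; ≤1    = [ x+y-1≤1 (value x) (value y) (𝕀.≤1 x) (𝕀.≤1 y) , 𝕀.≤1 0ᴵ ]′
  }
x ∧ y = record
  { value = min (value x) (value y)
  ; 0≤    = λ q<0 → 𝕀.0≤ x q<0 , 𝕀.0≤ y q<0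
  ; ≤1    = 𝕀.≤1 x ∘′ proj₁
  }

_* : 𝕀 → 𝕀
x * = record
  { value = 1ᴿ - value x
  ; 0≤    = 0≤1-x (value x) (𝕀.≤1 x)
  ; ≤1    = 1-x≤1 (value x) (𝕀.0≤ x)
  }

------------------------------------------------------------------------
-- Fuzzy sets

private
  variable
    ℓ ℓ′ : Level

FuzzySet : Set ℓ → Set (suc 0ℓ ⊔ ℓ)
FuzzySet X = X → 𝕀

module _ {X : Set ℓ} where

  infix  4 _≐_
  infixl 6 _⊕̇_
  infixl 7 _⊙̇_ _∧̇_
  infix  8 _*̇

  _≐_ : FuzzySet X → FuzzySet X → Set ℓ
  f ≐ g = ∀ x → f x ≈ᴵ g x

  𝟎 𝟏 : FuzzySet X
  𝟎 _ = 0ᴵ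
  𝟏 _ = 1ᴵ

  _⊕̇_ _⊙̇_ _∧̇_ : FuzzySet X → FuzzySet X → FuzzySet X
  (f ⊕̇ g) x = f x ⊕ g x
  (f ⊙̇ g) x = f x ⊙ g x
  (f ∧̇ g) x = f x ∧ g x

  _*̇ : FuzzySet X → FuzzySet X
  (f *̇) x = f x *

  -- The empty sum is 𝟎.
  ⨁ : List (FuzzySet X) → FuzzySet X
  ⨁ = foldr _⊕̇_ 𝟎

  -- f ≐ ⋁ Γ: at each point x, the value f x is the supremum in [0,1] of
  -- the values α x with α ∈ Γ.
  record IsJoin (Γ : Pred (FuzzySet X) ℓ′) (f : FuzzySet X)
                : Set (suc 0ℓ ⊔ ℓ ⊔ ℓ′) where
    field
      upper : ∀ x {α} → α ∈ Γ → α x ≤ᴵ f x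
      least : ∀ x (u : 𝕀) → (∀ {α} → α ∈ Γ → α x ≤ᴵ u) → f x ≤ᴵ u

------------------------------------------------------------------------
-- MV-topological spaces
--
-- Subsets of [0,1]^X of which joins are taken are predicates of the
-- level of [0,1]^X itself, while topologies live one level higher: the
-- smallest topology containing a given set is defined by quantifying
-- over all such subsets.  Under excluded middle, each predicate is
-- equivalent to one of any given level, so the levels carry no
-- mathematical content.

Subset : Set ℓ → Set (suc (suc 0ℓ ⊔ ℓ))
Subset {ℓ} X = Pred (FuzzySet X) (suc 0ℓ ⊔ ℓ)

LargeSubset : Set ℓ → Set (suc (suc (suc 0ℓ ⊔ ℓ)))
LargeSubset {ℓ} X = Pred (FuzzySet X) (suc (suc 0ℓ ⊔ ℓ))

record IsMVTopology {X : Set ℓ} (τ : Pred (FuzzySet X) ℓ′)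
                    : Set (suc (suc 0ℓ ⊔ ℓ) ⊔ ℓ′) where
  field
    𝟎-open : 𝟎 ∈ τ
    𝟏-open : 𝟏 ∈ τ
    ⋁-open : ∀ (Γ : Subset X) → Γ ⊆ τ → ∀ {f} → IsJoin Γ f → f ∈ τ
    ⊙-open : ∀ {f g} → f ∈ τ → g ∈ τ → f ⊙̇ g ∈ τ
    ⊕-open : ∀ {f g} → f ∈ τ → g ∈ τ → f ⊕̇ g ∈ τ
    ∧-open : ∀ {f g} → f ∈ τ → g ∈ τ → f ∧̇ g ∈ τ

  -- Taking Γ = {f}, topologies are automatically closed under _≐_.
  ≐-open : ∀ {f g} → f ≐ g → f ∈ τ → g ∈ τ
  ≐-open {f} f≐g f∈ = ⋁-open (_≡ f) (λ { refl → f∈ }) record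
    { upper = λ { x refl → proj₁ (f≐g x) }
    ; least = λ x u h q∈ → h refl (proj₂ (f≐g x) q∈)
    }

record MVSpace ℓ : Set (suc (suc (suc 0ℓ ⊔ ℓ))) where
  field
    Carrier      : Set ℓ
    τ            : LargeSubset Carrier
    isMVTopology : IsMVTopology τ

module _ (𝒳 : MVSpace ℓ) where

  open MVSpace 𝒳 renaming (Carrier to X)

  Closed Clopen : LargeSubset X
  Closed f = ∃ λ o → o ∈ τ × f ≐ (o *̇)
  Clopen f = f ∈ τ × f ∈ Closed

  IsBase : LargeSubset X → Set (suc (suc 0ℓ ⊔ ℓ))
  IsBase B = B ⊆ τ × (∀ {o} → o ∈ τ → Σ (Subset X) λ Γ → Γ ⊆ B × IsJoin Γ o)

  IsZeroDimensional : Set (suc (suc (suc 0ℓ ⊔ ℓ)))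
  IsZeroDimensional = Σ (LargeSubset X) λ B → IsBase B × B ⊆ Clopen

  IsHausdorff : Set (suc (suc 0ℓ ⊔ ℓ))
  IsHausdorff = ∀ {x y : X} → x ≢ y → ∃₂ λ o₁ o₂ →
    o₁ ∈ τ × o₂ ∈ τ × o₁ x ≈ᴵ 1ᴵ × o₂ y ≈ᴵ 1ᴵ × o₁ ∧̇ o₂ ≐ 𝟎

  IsCompact : Set (suc (suc 0ℓ ⊔ ℓ))
  IsCompact = ∀ (Γ : Subset X) → Γ ⊆ τ → IsJoin Γ 𝟏 →
    ∃ λ αs → All Γ αs × ⨁ αs ≐ 𝟏

  record IsStone : Set (suc (suc (suc 0ℓ ⊔ ℓ))) where
    field
      compact         : IsCompact
      hausdorff       : IsHausdorff
      zeroDimensional : IsZeroDimensional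

------------------------------------------------------------------------
-- The MV-topology generated by a subbase, and product spaces

data Generated {X : Set ℓ} (S : LargeSubset X) : LargeSubset X where
  subbase : ∀ {f} → f ∈ S → f ∈ Generated S
  𝟎-gen   : 𝟎 ∈ Generated S
  𝟏-gen   : 𝟏 ∈ Generated S
  ⋁-gen   : ∀ (Γ : Subset X) → Γ ⊆ Generated S →
            ∀ {f} → IsJoin Γ f → f ∈ Generated S
  ⊙-gen   : ∀ {f g} → f ∈ Generated S → g ∈ Generated S → f ⊙̇ g ∈ Generated S
  ⊕-gen   : ∀ {f g} → f ∈ Generated S → g ∈ Generated S → f ⊕̇ g ∈ Generated S
  ∧-gen   : ∀ {f g} → f ∈ Generated S → g ∈ Generated S → f ∧̇ g ∈ Generated S

generated-isMVTopology : {X : Set ℓ} (S : LargeSubset X) → IsMVTopology (Generated S)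
generated-isMVTopology S = record
  { 𝟎-open = 𝟎-gen
  ; 𝟏-open = 𝟏-gen
  ; ⋁-open = ⋁-gen
  ; ⊙-open = ⊙-gen
  ; ⊕-open = ⊕-gen
  ; ∧-open = ∧-gen
  }

generated-smallest : {X : Set ℓ} (S : LargeSubset X) {σ : Pred (FuzzySet X) ℓ′} →
                     IsMVTopology σ → S ⊆ σ → Generated S ⊆ σ
generated-smallest S {σ} σ-top S⊆σ = go
  where
  open IsMVTopology σ-top
  go : Generated S ⊆ σ
  go (subbase f∈)  = S⊆σ f∈
  go 𝟎-gen         = 𝟎-open
  go 𝟏-gen         = 𝟏-open
  go (⋁-gen Γ s j) = ⋁-open Γ (λ α∈ → go (s α∈)) j
  go (⊙-gen f∈ g∈) = ⊙-open (go f∈) (go g∈)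
  go (⊕-gen f∈ g∈) = ⊕-open (go f∈) (go g∈)
  go (∧-gen f∈ g∈) = ∧-open (go f∈) (go g∈)

module _ {I : Set ℓ} (𝒳 : I → MVSpace ℓ) where

  private module 𝒳 i = MVSpace (𝒳 i)

  ΠCarrier : Set ℓ
  ΠCarrier = ∀ i → 𝒳.Carrier i

  π : ∀ i → ΠCarrier → 𝒳.Carrier i
  π i x = x i

  productSubbase : LargeSubset ΠCarrier
  productSubbase f = ∃₂ λ i α → α ∈ 𝒳.τ i × f ≡ α ∘ π i

  Product : MVSpace ℓ
  Product = record
    { Carrier      = ΠCarrier
    ; τ            = Generated productSubbase
    ; isMVTopology = generated-isMVTopology productSubbase
    }

------------------------------------------------------------------------
-- The classical metatheory
--
-- As ExcludedMiddle decides arbitrary types, not only propositions, it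
-- turns ¬ ¬ A into an element of A and hence also supplies choice.
-- Function extensionality is needed for propositional equality to be
-- the equality of points of a product.

Classical : Setω
Classical = ∀ {a} → ExcludedMiddle a

FunExt : Setω
FunExt = ∀ {a b} → Extensionality a b

{-# OPTIONS --safe #-}
module Submission where

-- Compactness is Tychonoff's theorem for the ordinary topology of the
-- level sets { f > q }.  For q < r iterated doubling t ⊕ t and squaring
-- t ⊙ t yield an operation φ with φ t = 1 for t > r and φ t = 0 for
-- t ≤ q, so an MV-compact space is compact for its level sets.  Suppose a
-- cover Γ of the product has no finite subfamily (with repetitions) of sum
-- 1.  Then no finitely many of the sets { α > ½ }, α ∈ Γ, cover the
-- product, since the sum of all α ⊕ α would be 1.  Extend these sets to a
-- maximal family M without finite subcover.  Compactness of each factor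
-- gives a point x such that no { α ∘ πᵢ > q } with α (x i) > q is in M; by
-- induction over the generated topology the same holds for all opens,
-- which contradicts α x > ½ for some α ∈ Γ.
--
-- For zero-dimensionality, clopens are closed under ⊕, ⊙ and ∧ by De
-- Morgan's laws, so that every generated open is the join of the clopens
-- below it.

open import Defs
open import Algebra.Properties.CommutativeMonoid.Mult using (×-distrib-+)
open import Data.Bool.Base using (Bool; T; true; false)
open import Data.Empty using (⊥-elim)
open import Data.Integer.Base as ℤ using (+_; -[1+_])
import Data.Integer.Properties as ℤₚ
open import Data.List.Base using (List; []; _∷_; _++_)
open import Data.List.Relation.Unary.All as All using (All; []; _∷_)
import Data.List.Relation.Unary.All.Properties as Allₚ
open import Data.List.Relation.Unary.Any using (Any; here; there)
import Data.List.Relation.Unary.Any.Properties as Anyₚ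
import Data.Nat.Base as ℕ
import Data.Nat.Properties as ℕₚ
open import Data.Product.Base using (∃; ∃₂; _×_; _,_; proj₁; proj₂)
open import Data.Rational.Base as ℚ using (ℚ; mkℚ; 0ℚ; 1ℚ; ½; toℚᵘ)
import Data.Rational.Properties as ℚₚ
open import Data.Rational.Solver using (module +-*-Solver)
open import Data.Rational.Unnormalised.Base as ℚᵘ using (mkℚᵘ; *≤*; *≡*)
import Data.Rational.Unnormalised.Properties as ℚᵘₚ
open import Data.Sum.Base as Sum using (_⊎_; inj₁; inj₂; [_,_]′)
open import Data.Unit.Base using (tt)
open import Function.Base using (id; _∘_; case_of_)
open import Level using (Level; Lift; lift; 0ℓ)
open import Relation.Binary.Definitions using (tri<; tri≈; tri>)
open import Relation.Binary.PropositionalEquality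
  using (_≡_; refl; sym; trans; cong; subst; subst₂)
open import Relation.Nullary.Decidable
  using (yes; no; isYes; toWitness; fromWitness; decidable-stable; from-yes)
open import Relation.Nullary.Negation using (¬_; contradiction)
open import Relation.Unary using (Pred)

open import Algebra.Definitions.RawMonoid ℚ.+-0-rawMonoid using () renaming (_×_ to _·_)
open +-*-Solver using (solve; con; _:=_; _:+_; _:-_; _:*_; :-_)
open ℝ using (lower)
open 𝕀 using (value)

private
  variable
    a p ℓ ℓ′ : Level
    A        : Set a

-- Rational arithmetic

-- A linear inequality a < b follows from a combination l < r of others
-- whenever b - a ≡ r - l; without subtraction, the ring solver's side
-- condition reads as follows.
<-from : ∀ {l r a b} → l ℚ.< r → b ℚ.+ l ≡ a ℚ.+ r → a ℚ.< b
<-from {l} {r} {a} {b} l<r eq = ℚₚ.≰⇒> λ b≤a →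
  ℚₚ.<-irrefl eq (ℚₚ.+-mono-≤-< b≤a l<r)

≤-from : ∀ {l r a b} → l ℚ.≤ r → b ℚ.+ l ≡ a ℚ.+ r → a ℚ.≤ b
≤-from {l} {r} {a} {b} l≤r eq = ℚₚ.≮⇒≥ λ b<a →
  ℚₚ.<-irrefl eq (ℚₚ.+-mono-<-≤ b<a l≤r)

-- Among unnormalised rationals `k · ε` is a product of two fractions, which reduces `archimedean`
-- to a cross-multiplied inequality of natural numbers.
·-toℚᵘ : ∀ k ε → toℚᵘ (k · ε) ℚᵘ.≃ mkℚᵘ (+ k) 0 ℚᵘ.* toℚᵘ ε
·-toℚᵘ ℕ.zero ε = ℚᵘₚ.≃-sym (ℚᵘₚ.*-zeroˡ (toℚᵘ ε))
·-toℚᵘ (ℕ.suc k) ε = begin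
  toℚᵘ (ε ℚ.+ k · ε)                        ≈⟨ ℚₚ.toℚᵘ-homo-+ ε (k · ε) ⟩
  e ℚᵘ.+ toℚᵘ (k · ε)                       ≈⟨ ℚᵘₚ.+-cong (ℚᵘₚ.≃-sym (ℚᵘₚ.*-identityˡ e)) (·-toℚᵘ k ε) ⟩
  ℚᵘ.1ℚᵘ ℚᵘ.* e ℚᵘ.+ mkℚᵘ (+ k) 0 ℚᵘ.* e    ≈⟨ ℚᵘₚ.*-distribʳ-+ e ℚᵘ.1ℚᵘ (mkℚᵘ (+ k) 0) ⟨
  (ℚᵘ.1ℚᵘ ℚᵘ.+ mkℚᵘ (+ k) 0) ℚᵘ.* e         ≈⟨ ℚᵘₚ.*-cong 1+k (ℚᵘₚ.≃-refl {e}) ⟩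
  mkℚᵘ (+ ℕ.suc k) 0 ℚᵘ.* e                 ∎
  where
  open import Relation.Binary.Reasoning.Setoid ℚᵘₚ.≃-setoid
  e = toℚᵘ ε
  1+k : ℚᵘ.1ℚᵘ ℚᵘ.+ mkℚᵘ (+ k) 0 ℚᵘ.≃ mkℚᵘ (+ ℕ.suc k) 0
  1+k = *≡* (cong (λ z → (+ 1 ℤ.+ z) ℤ.* + 1) (ℤₚ.*-identityʳ (+ k)))

archimedean : ∀ b {ε} → 0ℚ ℚ.< ε → ∃ λ k → b ℚ.≤ k · ε
archimedean (mkℚ -[1+ n ] c _) 0<ε = 0 , ℚₚ.<⇒≤ (ℚₚ.negative⁻¹ _)
archimedean b@(mkℚ (+ n) c _) {ε@(mkℚ (+ ℕ.suc p) d _)} 0<ε = k , ℚₚ.toℚᵘ-cancel-≤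
  (ℚᵘₚ.≤-respʳ-≃ (ℚᵘₚ.≃-sym (·-toℚᵘ k ε)) (*≤* (subst₂ ℤ._≤_ (ℤₚ.pos-* n _)
    (trans (ℤₚ.pos-* (k ℕ.* ℕ.suc p) (ℕ.suc c)) (cong (ℤ._* + ℕ.suc c) (ℤₚ.pos-* k (ℕ.suc p))))
    (ℤ.+≤+ le))))
  where
  -- The factor `suc d` cancels the denominator of `ε`, so `k · ε` is `n` times a positive
  -- numerator, hence at least `n` and at least `b`.
  k = n ℕ.* ℕ.suc d
  le : n ℕ.* ℕ.suc (d ℕ.+ 0) ℕ.≤ k ℕ.* ℕ.suc p ℕ.* ℕ.suc c
  le rewrite ℕₚ.+-identityʳ d = ℕₚ.≤-trans (ℕₚ.m≤m*n k (ℕ.suc p)) (ℕₚ.m≤m*n (k ℕ.* ℕ.suc p) (ℕ.suc c))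
archimedean b@(mkℚ (+ n) c _) {mkℚ (+ 0) d _} (ℚ.*<* (ℤ.+<+ ()))
archimedean b@(mkℚ (+ n) c _) {mkℚ -[1+ p ] d _} (ℚ.*<* ())

-- Induction on a `k` with `b ≤ k · ε`: passing to `ε + ε` lets `k` drop by one as long as it is at
-- least 2.
doubling-induction : ∀ {p} (P : ℚ → Set p) b →
  (∀ {ε} → b ℚ.≤ ε → P ε) → (∀ {ε} → 0ℚ ℚ.< ε → P (ε ℚ.+ ε) → P ε) →
  ∀ {ε} → 0ℚ ℚ.< ε → P ε
doubling-induction P b base step {ε} 0<ε = let k , b≤ = archimedean b 0<ε in go k 0<ε b≤
  where
  0≤· : ∀ k {ε} → 0ℚ ℚ.< ε → 0ℚ ℚ.≤ k · ε
  0≤· ℕ.zero    0<ε = ℚₚ.≤-refl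
  0≤· (ℕ.suc k) 0<ε = ℚₚ.+-mono-≤ (ℚₚ.<⇒≤ 0<ε) (0≤· k 0<ε)

  go : ∀ k {ε} → 0ℚ ℚ.< ε → b ℚ.≤ k · ε → P ε
  go 0 0<ε b≤ = base (ℚₚ.≤-trans b≤ (ℚₚ.<⇒≤ 0<ε))
  go 1 {ε} 0<ε b≤ = base (subst (b ℚ.≤_) (ℚₚ.+-identityʳ ε) b≤)
  go (ℕ.suc k@(ℕ.suc j)) {ε} 0<ε b≤ = step 0<ε (go k (ℚₚ.+-mono-< 0<ε 0<ε) (ℚₚ.≤-trans b≤ le))
    where
    le : ε ℚ.+ k · ε ℚ.≤ k · (ε ℚ.+ ε)
    le = subst (ε ℚ.+ k · ε ℚ.≤_) (sym (×-distrib-+ ℚₚ.+-0-commutativeMonoid ε ε k))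
      (ℚₚ.+-monoˡ-≤ (k · ε) (≤-from {a = ε} {b = k · ε} (0≤· j 0<ε)
        (ℚₚ.+-identityʳ (k · ε))))

-- Cuts and MV-operations

2ℚ : ℚ
2ℚ = 1ℚ ℚ.+ 1ℚ

downward-≤ : ∀ x {p q} → p ℚ.≤ q → lower x q → lower x p
downward-≤ x {p} {q} p≤q q∈ with ℚₚ.<-cmp p q
... | tri< p<q _ _  = ℝ.downward x p<q q∈
... | tri≈ _ refl _ = q∈
... | tri> _ _ q<p  = contradiction (ℚₚ.<-≤-trans q<p p≤q) (ℚₚ.<-irrefl refl)

-- With `complement⁻`, this reduces membership in `1ᴿ - x` to one linear inequality about a rational
-- outside `x`, so that De Morgan's laws become rational arithmetic.
complement⁺ : ∀ x {q r} → ¬ lower x r → q ℚ.+ r ℚ.< 1ℚ → lower (1ᴿ - x) q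
complement⁺ x {q} {r} r∉ q+r<1 with s , q+r<s , s<1 ← ℚₚ.<-dense q+r<1 =
  s , q ℚ.- s , s<1
  , (r , r∉ , <-from q+r<s (solve 3 (λ q r s → (:- r) :+ (q :+ r) := (q :- s) :+ s) refl q r s))
  , solve 2 (λ q s → q := s :+ (q :- s)) refl q s

complement⁻ : ∀ x {q} → lower (1ᴿ - x) q → ∃ λ r → ¬ lower x r × q ℚ.+ r ℚ.< 1ℚ
complement⁻ x (a , c , a<1 , (r , r∉ , c<-r) , refl) = r , r∉ ,
  <-from (ℚₚ.+-mono-< a<1 c<-r)
    (solve 3 (λ a c r → con 1ℚ :+ (a :+ c) := ((a :+ c) :+ r) :+ (con 1ℚ :+ (:- r))) refl a c r)

complement-+⁺ : ∀ x y {q r s} → ¬ lower x r → ¬ lower y s → q ℚ.+ (r ℚ.+ s) ℚ.< 2ℚ →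
                lower ((1ᴿ - x) + (1ᴿ - y)) q
complement-+⁺ x y {q} {r} {s} r∉ s∉ lt =
  -- `q` is split so that adding `r` to one part and `s` to the other gives the same sum, half of q
  -- + (r + s).
  ½ ℚ.* (q ℚ.- r ℚ.+ s) , ½ ℚ.* (q ℚ.+ r ℚ.- s)
  , complement⁺ x r∉ (subst (ℚ._< 1ℚ)
      (solve 3 (λ q r s → con ½ :* (q :+ (r :+ s)) := con ½ :* (q :- r :+ s) :+ r) refl q r s) half)
  , complement⁺ y s∉ (subst (ℚ._< 1ℚ)
      (solve 3 (λ q r s → con ½ :* (q :+ (r :+ s)) := con ½ :* (q :+ r :- s) :+ s) refl q r s) half)
  , solve 3 (λ q r s → q := con ½ :* (q :- r :+ s) :+ con ½ :* (q :+ r :- s)) refl q r s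
  where
  half : ½ ℚ.* (q ℚ.+ (r ℚ.+ s)) ℚ.< 1ℚ
  half = ℚₚ.*-monoʳ-<-pos ½ lt

complement-+⁻ : ∀ x y {q} → lower ((1ᴿ - x) + (1ᴿ - y)) q →
                ∃₂ λ r s → ¬ lower x r × ¬ lower y s × q ℚ.+ (r ℚ.+ s) ℚ.< 2ℚ
complement-+⁻ x y (a , b , a∈ , b∈ , refl)
  with r , r∉ , a+r<1 ← complement⁻ x a∈ | s , s∉ , b+s<1 ← complement⁻ y b∈ =
  r , s , r∉ , s∉ , subst (ℚ._< 2ℚ)
    (solve 4 (λ a b r s → (a :+ r) :+ (b :+ s) := (a :+ b) :+ (r :+ s)) refl a b r s)
    (ℚₚ.+-mono-< a+r<1 b+s<1)

-1⁺ : ∀ x {q p} → lower x p → q ℚ.+ 1ℚ ℚ.< p → lower (x - 1ᴿ) q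
-1⁺ x {q} {p} p∈ q+1<p =
  p , q ℚ.- p , p∈
  , (1ℚ , ℚₚ.<-irrefl refl
     , <-from q+1<p (solve 2 (λ q p → con (ℚ.- 1ℚ) :+ (q :+ con 1ℚ) := (q :- p) :+ p) refl q p))
  , solve 2 (λ q p → q := p :+ (q :- p)) refl q p

-1⁻ : ∀ x {q} → lower (x - 1ᴿ) q → ∃ λ p → lower x p × q ℚ.+ 1ℚ ℚ.< p
-1⁻ x (p , c , p∈ , (t , t≮1 , c<-t) , refl) = p , p∈ ,
  <-from (ℚₚ.<-≤-trans c<-t (ℚₚ.neg-antimono-≤ (ℚₚ.≮⇒≥ t≮1)))
    (solve 2 (λ p c → p :+ c := (p :+ c :+ con 1ℚ) :+ con (ℚ.- 1ℚ)) refl p c)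

∉-+ : ∀ x y {r s} → ¬ lower x r → ¬ lower y s → ¬ lower (x + y) (r ℚ.+ s)
∉-+ x y r∉ s∉ (a , b , a∈ , b∈ , eq) =
  ℚₚ.<-irrefl (sym eq) (ℚₚ.+-mono-< (ℝ.∈<∉ x a∈ r∉) (ℝ.∈<∉ y b∈ s∉))

∉-+-1 : ∀ x y {r s u} → ¬ lower x r → ¬ lower y s → r ℚ.+ s ℚ.≤ u ℚ.+ 1ℚ →
        ¬ lower (x + y - 1ᴿ) u
∉-+-1 x y r∉ s∉ le u∈ with p , p∈ , u+1<p ← -1⁻ (x + y) u∈ =
  ∉-+ x y r∉ s∉ (downward-≤ (x + y) (ℚₚ.≤-trans le (ℚₚ.<⇒≤ u+1<p)) p∈)

-- De Morgan's laws

module DeMorgan (em : Classical) where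

  -- Bisection: if the cut ends within an interval of length `ε + ε`, excluded middle at the
  -- midpoint `a + ε` tells in which half.
  located : ∀ x {ε} → 0ℚ ℚ.< ε → ∃ λ a → lower x a × ¬ lower x (a ℚ.+ ε)
  located x = doubling-induction _ (u ℚ.- a₀) base step
    where
    a₀ = proj₁ (ℝ.inhabited x)
    u  = proj₁ (ℝ.bounded x)

    base : ∀ {ε} → u ℚ.- a₀ ℚ.≤ ε → ∃ λ a → lower x a × ¬ lower x (a ℚ.+ ε)
    base {ε} le = a₀ , proj₂ (ℝ.inhabited x) , λ a₀+ε∈ → proj₂ (ℝ.bounded x)
      (downward-≤ x (≤-from le (solve 3 (λ a u e → (a :+ e) :+ (u :- a) := u :+ e) refl a₀ u ε)) a₀+ε∈)

    step : ∀ {ε} → 0ℚ ℚ.< ε → (∃ λ a → lower x a × ¬ lower x (a ℚ.+ (ε ℚ.+ ε))) →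
           ∃ λ a → lower x a × ¬ lower x (a ℚ.+ ε)
    step {ε} _ (a , a∈ , ∉) with em {P = lower x (a ℚ.+ ε)}
    ... | yes a+ε∈ = a ℚ.+ ε , a+ε∈ , ∉ ∘ subst (lower x) (ℚₚ.+-assoc a ε ε)
    ... | no a+ε∉  = a , a∈ , a+ε∉

  +-located : ∀ x y {ε} → 0ℚ ℚ.< ε → ∃₂ λ r s → ¬ lower x r × ¬ lower y s ×
              ∃ λ p → lower (x + y) p × r ℚ.+ s ℚ.< p ℚ.+ ε
  +-located x y {ε} 0<ε =
    let d , 0<d , d<ε = ℚₚ.<-dense 0<ε
        0<d/2         = ℚₚ.*-monoʳ-<-pos ½ 0<d
        a , a∈ , a+∉  = located x 0<d/2
        b , b∈ , b+∉  = located y 0<d/2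
    in a ℚ.+ ½ ℚ.* d , b ℚ.+ ½ ℚ.* d , a+∉ , b+∉ , a ℚ.+ b , (a , b , a∈ , b∈ , refl) ,
       subst (ℚ._< a ℚ.+ b ℚ.+ ε)
         (solve 3 (λ a b d → a :+ b :+ d := (a :+ con ½ :* d) :+ (b :+ con ½ :* d)) refl a b d)
         (ℚₚ.+-monoʳ-< (a ℚ.+ b) d<ε)

  0<1- : ∀ {p} → p ℚ.< 1ℚ → 0ℚ ℚ.< 1ℚ ℚ.- p
  0<1- {p} p<1 = <-from p<1 (solve 1 (λ p → (con 1ℚ :- p) :+ p := con 0ℚ :+ con 1ℚ) refl p)

  *-⊕ : ∀ x y → x * ⊕ y * ≈ᴵ (x ⊙ y) *
  *-⊕ x y = to , from
    where
    X = value x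
    Y = value y

    to′ : ∀ {q r s} → q ℚ.< 1ℚ → ¬ lower X r → ¬ lower Y s → q ℚ.+ (r ℚ.+ s) ℚ.< 2ℚ →
          lower (value ((x ⊙ y) *)) q
    -- The expected bound r + s - 1 may be negative and thus inside the cut of 0 that truncates `⊙`;
    -- then 0 replaces it.
    to′ {q} {r} {s} q<1 r∉ s∉ lt with ℚₚ.≤-total 0ℚ (r ℚ.+ s ℚ.- 1ℚ)
    ... | inj₁ 0≤u = complement⁺ (value (x ⊙ y)) {r = r ℚ.+ s ℚ.- 1ℚ}
      [ ∉-+-1 X Y r∉ s∉ (ℚₚ.≤-reflexive
          (solve 1 (λ t → t := t :- con 1ℚ :+ con 1ℚ) refl (r ℚ.+ s)))
      , (λ u<0 → ℚₚ.<-irrefl refl (ℚₚ.<-≤-trans u<0 0≤u)) ]′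
      (<-from lt (solve 2 (λ q t → con 1ℚ :+ (q :+ t) := (q :+ (t :- con 1ℚ)) :+ con 2ℚ) refl q (r ℚ.+ s)))
    ... | inj₂ u≤0 = complement⁺ (value (x ⊙ y)) {r = 0ℚ}
      [ ∉-+-1 X Y r∉ s∉ (≤-from u≤0
          (solve 1 (λ t → (con 0ℚ :+ con 1ℚ) :+ (t :- con 1ℚ) := t :+ con 0ℚ) refl (r ℚ.+ s)))
      , ℚₚ.<-irrefl refl ]′
      (subst (ℚ._< 1ℚ) (sym (ℚₚ.+-identityʳ q)) q<1)

    to : x * ⊕ y * ≤ᴵ (x ⊙ y) *
    to (q∈ , q<1) = let _ , _ , r∉ , s∉ , lt = complement-+⁻ X Y q∈ in to′ q<1 r∉ s∉ lt

    from : (x ⊙ y) * ≤ᴵ x * ⊕ y *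
    from {q} q∈ =
      let u , u∉ , q+u<1 = complement⁻ (value (x ⊙ y)) q∈
          -- The tolerance 1 - (q + u) is the available slack: with p ≤ u + 1 it yields r + s < 2 -
          -- q.
          r , s , r∉ , s∉ , p , p∈ , r+s<p+ε = +-located X Y (0<1- q+u<1)
          p≤u+1 = ℚₚ.≮⇒≥ λ u+1<p → u∉ (inj₁ (-1⁺ (X + Y) p∈ u+1<p))
      in complement-+⁺ X Y r∉ s∉
        (<-from (ℚₚ.+-mono-<-≤ r+s<p+ε p≤u+1)
          (solve 4 (λ q u t p → con 2ℚ :+ (t :+ p) :=
            (q :+ t) :+ ((p :+ (con 1ℚ :- (q :+ u))) :+ (u :+ con 1ℚ))) refl q u (r ℚ.+ s) p))
      , <-from (ℚₚ.+-mono-<-≤ q+u<1 (ℚₚ.≮⇒≥ (u∉ ∘ inj₂)))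
          (solve 2 (λ q u → con 1ℚ :+ ((q :+ u) :+ con 0ℚ) := q :+ (con 1ℚ :+ u)) refl q u)

  *-⊙ : ∀ x y → x * ⊙ y * ≈ᴵ (x ⊕ y) *
  *-⊙ x y = to , from
    where
    X = value x
    Y = value y

    to : x * ⊙ y * ≤ᴵ (x ⊕ y) *
    to {q} (inj₁ q∈) =
      let p , p∈ , q+1<p = -1⁻ (value (x *) + value (y *)) q∈
          r , s , r∉ , s∉ , lt = complement-+⁻ X Y p∈
      in complement⁺ (value (x ⊕ y)) (∉-+ X Y r∉ s∉ ∘ proj₁)
        (<-from (ℚₚ.+-mono-< q+1<p lt)
          (solve 3 (λ q p t → con 1ℚ :+ ((q :+ con 1ℚ) :+ (p :+ t)) := (q :+ t) :+ (p :+ con 2ℚ))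
            refl q p (r ℚ.+ s)))
    to (inj₂ q<0) = complement⁺ (value (x ⊕ y)) {r = 1ℚ} (ℚₚ.<-irrefl refl ∘ proj₂)
      (ℚₚ.+-monoˡ-< 1ℚ q<0)

    from′ : ∀ {q u} → ¬ lower (value (x ⊕ y)) u → q ℚ.+ u ℚ.< 1ℚ → lower (value (x * ⊙ y *)) q
    from′ {q} {u} u∉ q+u<1 with u ℚₚ.<? 1ℚ
    -- Beyond the truncation of `⊕` at 1, `u` says nothing about the sum, but it forces q < 0.
    ... | no u≮1  = inj₂ (<-from (ℚₚ.+-mono-<-≤ q+u<1 (ℚₚ.≮⇒≥ u≮1))
      (solve 2 (λ q u → con 0ℚ :+ ((q :+ u) :+ con 1ℚ) := q :+ (con 1ℚ :+ u)) refl q u))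
    ... | yes u<1 =
      let r , s , r∉ , s∉ , p , p∈ , r+s<p+ε = +-located X Y (0<1- q+u<1)
          p≤u = ℚₚ.≮⇒≥ λ u<p → u∉ (ℝ.downward (X + Y) u<p p∈ , u<1)
          -- Subtracting 1 requires strict room above q + 1, which `v` provides.
          v , q+1<v , v<2- = ℚₚ.<-dense {q ℚ.+ 1ℚ} {2ℚ ℚ.- (r ℚ.+ s)}
            (<-from (ℚₚ.+-mono-<-≤ r+s<p+ε p≤u)
              (solve 4 (λ q u t p → (con 2ℚ :- t) :+ (t :+ p) :=
                (q :+ con 1ℚ) :+ ((p :+ (con 1ℚ :- (q :+ u))) :+ u)) refl q u (r ℚ.+ s) p))
      in inj₁ (-1⁺ (value (x *) + value (y *))
        (complement-+⁺ X Y r∉ s∉ (<-from v<2-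
          (solve 2 (λ v t → con 2ℚ :+ v := (v :+ t) :+ (con 2ℚ :- t)) refl v (r ℚ.+ s)))) q+1<v)

    from : (x ⊕ y) * ≤ᴵ x * ⊙ y *
    from q∈ = let _ , u∉ , lt = complement⁻ (value (x ⊕ y)) q∈ in from′ u∉ lt

infixl 7 _∨_

-- The De Morgan dual of `_∧_`; pointwise it is a binary join, so it preserves openness.
_∨_ : 𝕀 → 𝕀 → 𝕀
x ∨ y = record
  { value = max (value x) (value y)
  ; 0≤    = inj₁ ∘ 𝕀.0≤ x
  ; ≤1    = [ 𝕀.≤1 x , 𝕀.≤1 y ]′
  }

*-antitone : ∀ x y → x ≤ᴵ y → y * ≤ᴵ x *
*-antitone x y x≤y (a , c , a<1 , (r , r∉ , c<-r) , eq) =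
  a , c , a<1 , (r , r∉ ∘ x≤y , c<-r) , eq

*-∧ : ∀ x y → x * ∧ y * ≈ᴵ (x ∨ y) *
*-∧ x y = to , λ q∈ → *-antitone x (x ∨ y) inj₁ q∈ , *-antitone y (x ∨ y) inj₂ q∈
  where
  X = value x
  Y = value y
  to : x * ∧ y * ≤ᴵ (x ∨ y) *
  to (q∈x* , q∈y*) with r , r∉ , q+r<1 ← complement⁻ X q∈x* | s , s∉ , q+s<1 ← complement⁻ Y q∈y*
    with ℚₚ.≤-total r s
  -- The larger of `r` and `s` lies outside both cuts.
  ... | inj₁ r≤s = complement⁺ (value (x ∨ y)) [ r∉ ∘ downward-≤ X r≤s , s∉ ]′ q+s<1
  ... | inj₂ s≤r = complement⁺ (value (x ∨ y)) [ r∉ , s∉ ∘ downward-≤ Y s≤r ]′ q+r<1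

-- Monotonicity, doubling and squaring

+-mono : ∀ w x y z → w ≤ x → y ≤ z → w + y ≤ x + z
+-mono w x y z w≤x y≤z (a , b , a∈ , b∈ , eq) = a , b , w≤x a∈ , y≤z b∈ , eq

⊕-mono : ∀ w x y z → w ≤ᴵ x → y ≤ᴵ z → w ⊕ y ≤ᴵ x ⊕ z
⊕-mono w x y z w≤x y≤z (q∈ , q<1) = +-mono (value w) (value x) (value y) (value z) w≤x y≤z q∈ , q<1

⊙-mono : ∀ w x y z → w ≤ᴵ x → y ≤ᴵ z → w ⊙ y ≤ᴵ x ⊙ z
⊙-mono w x y z w≤x y≤z = Sum.map₁ (λ (p , c , p∈ , c∈ , eq) →
  p , c , +-mono (value w) (value x) (value y) (value z) w≤x y≤z p∈ , c∈ , eq)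

∧-mono : ∀ w x y z → w ≤ᴵ x → y ≤ᴵ z → w ∧ y ≤ᴵ x ∧ z
∧-mono w x y z w≤x y≤z (q∈w , q∈y) = w≤x q∈w , y≤z q∈y

-- Of two rationals with sum at least q + q, one is at least `q`.
+-diag : ∀ x {p q} → lower (x + x) p → q ℚ.+ q ℚ.≤ p → lower x q
+-diag x {q = q} (a , b , a∈ , b∈ , refl) 2q≤ with ℚₚ.≤-total q a | ℚₚ.≤-total q b
... | inj₁ q≤a | _ = downward-≤ x q≤a a∈
... | inj₂ _   | inj₁ q≤b = downward-≤ x q≤b b∈
... | inj₂ a≤q | inj₂ b≤q = downward-≤ x (≤-from (ℚₚ.≤-trans 2q≤ (ℚₚ.+-monoˡ-≤ b a≤q))
  (solve 2 (λ b q → b :+ (q :+ q) := q :+ (q :+ b)) refl b q)) b∈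

⊕-diag⁻ : ∀ t {q} → lower (value (t ⊕ t)) (q ℚ.+ q) → lower (value t) q
⊕-diag⁻ t (2q∈ , _) = +-diag (value t) 2q∈ ℚₚ.≤-refl

⊕-diag⁺ : ∀ t {r} → lower (value t) r → r ℚ.+ r ℚ.< 1ℚ → lower (value (t ⊕ t)) (r ℚ.+ r)
⊕-diag⁺ t {r} r∈ 2r<1 = (r , r , r∈ , r∈ , refl) , 2r<1

⊕-diag-1 : ∀ t {r} → lower (value t) r → 1ℚ ℚ.≤ r ℚ.+ r → 1ᴵ ≤ᴵ t ⊕ t
⊕-diag-1 t {r} r∈ 1≤2r p<1 =
  ℝ.downward (value t + value t) (ℚₚ.<-≤-trans p<1 1≤2r) (r , r , r∈ , r∈ , refl) , p<1

-- `0 ≤ u` rules out the truncation at 0; an inequality for `q + q` rather than an equation admits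
-- `u` = 0 when 2q - 1 is negative.
⊙-diag⁻ : ∀ t {q u} → lower (value (t ⊙ t)) u → 0ℚ ℚ.≤ u → q ℚ.+ q ℚ.≤ u ℚ.+ 1ℚ → lower (value t) q
⊙-diag⁻ t (inj₁ u∈) 0≤u 2q≤ with p , p∈ , u+1<p ← -1⁻ (value t + value t) u∈ =
  +-diag (value t) p∈ (ℚₚ.≤-trans 2q≤ (ℚₚ.<⇒≤ u+1<p))
⊙-diag⁻ t (inj₂ u<0) 0≤u _ = contradiction (ℚₚ.<-≤-trans u<0 0≤u) (ℚₚ.<-irrefl refl)

⊙-diag⁺ : ∀ t {r} → lower (value t) r → lower (value (t ⊙ t)) (r ℚ.+ r ℚ.- 1ℚ)
⊙-diag⁺ t {r} r∈ with s , r<s , s∈ ← ℝ.rounded (value t) r∈ =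
  inj₁ (-1⁺ (value t + value t) (s , s , s∈ , s∈ , refl)
    (<-from (ℚₚ.+-mono-< r<s r<s)
      (solve 2 (λ r s → (s :+ s) :+ (r :+ r) := ((r :+ r :- con 1ℚ) :+ con 1ℚ) :+ (s :+ s)) refl r s)))

⊙-diag-1 : ∀ t → 1ᴵ ≤ᴵ t → 1ᴵ ≤ᴵ t ⊙ t
⊙-diag-1 t 1≤t {p} p<1 = subst (lower (value (t ⊙ t)))
  (solve 1 (λ p → con ½ :* (p :+ con 1ℚ) :+ con ½ :* (p :+ con 1ℚ) :- con 1ℚ := p) refl p)
  (⊙-diag⁺ t (1≤t (ℚₚ.*-monoʳ-<-pos ½ (ℚₚ.+-monoˡ-< 1ℚ p<1))))

-- Separating two levels by open operations

module Separation {ℓ ℓ′} {X : Set ℓ} {τ : Pred (FuzzySet X) ℓ′} (τ-top : IsMVTopology τ) where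
  open IsMVTopology τ-top

  -- φ is assembled from t ⊕ t and t ⊙ t alone, as constants strictly
  -- between 0 and 1 need not be open.
  Separator : Pred 𝕀 0ℓ → Pred 𝕀 0ℓ → Set _
  Separator P Q = ∃ λ φ → (∀ {f} → τ f → τ (φ ∘ f)) ×
    (∀ t → P t → 1ᴵ ≤ᴵ φ t) × (∀ t → lower (value (φ t)) 0ℚ → Q t)

  double : ∀ {P Q P′ Q′} → (∀ t → P t → P′ (t ⊕ t)) → (∀ t → Q′ (t ⊕ t) → Q t) →
           Separator P′ Q′ → Separator P Q
  double P⇒ Q⇐ (φ , open′ , one , zero) =
    (λ t → φ (t ⊕ t)) , (λ f∈ → open′ (⊕-open f∈ f∈))
    , (λ t → one (t ⊕ t) ∘ P⇒ t) , (λ t → Q⇐ t ∘ zero (t ⊕ t))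

  square : ∀ {P Q P′ Q′} → (∀ t → P t → P′ (t ⊙ t)) → (∀ t → Q′ (t ⊙ t) → Q t) →
           Separator P′ Q′ → Separator P Q
  square P⇒ Q⇐ (φ , open′ , one , zero) =
    (λ t → φ (t ⊙ t)) , (λ f∈ → open′ (⊙-open f∈ f∈))
    , (λ t → one (t ⊙ t) ∘ P⇒ t) , (λ t → Q⇐ t ∘ zero (t ⊙ t))

  Above : ℚ → Pred 𝕀 0ℓ
  Above q t = lower (value t) q

  IsOne : Pred 𝕀 0ℓ
  IsOne t = 1ᴵ ≤ᴵ t

  identity : ∀ {q} → q ℚ.≤ 0ℚ → Separator IsOne (Above q)
  identity q≤0 = id , id , (λ _ → id) , (λ t → downward-≤ (value t) q≤0)

  -- t ↦ t ⊙ t fixes 1 and doubles the distance from q to 1.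
  separate-1 : ∀ {ε} → 0ℚ ℚ.< ε → ∀ q → ε ≡ 1ℚ ℚ.- q → Separator IsOne (Above q)
  separate-1 = doubling-induction _ 1ℚ
    (λ { 1≤ε q refl → identity (≤-from 1≤ε
      (solve 1 (λ q → con 0ℚ :+ con 1ℚ := q :+ (con 1ℚ :- q)) refl q)) }) step
    where
    step : ∀ {ε} → 0ℚ ℚ.< ε → (∀ q → ε ℚ.+ ε ≡ 1ℚ ℚ.- q → Separator IsOne (Above q)) →
           ∀ q → ε ≡ 1ℚ ℚ.- q → Separator IsOne (Above q)
    step _ ih q refl with ℚₚ.≤-total 0ℚ (q ℚ.+ q ℚ.- 1ℚ)
    ... | inj₁ 0≤ = square {IsOne} {Above q} {IsOne} {Above (q ℚ.+ q ℚ.- 1ℚ)} ⊙-diag-1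
      (λ t h → ⊙-diag⁻ t h 0≤ (ℚₚ.≤-reflexive (solve 1 (λ q → q :+ q := q :+ q :- con 1ℚ :+ con 1ℚ) refl q)))
      (ih (q ℚ.+ q ℚ.- 1ℚ) (solve 1 (λ q → (con 1ℚ :- q) :+ (con 1ℚ :- q) :=
        con 1ℚ :- (q :+ q :- con 1ℚ)) refl q))
    -- One squaring already sends all values up to `q` to 0, so the iteration stops.
    ... | inj₂ ≤0 = square {IsOne} {Above q} {IsOne} {Above 0ℚ} ⊙-diag-1
      (λ t h → ⊙-diag⁻ t h ℚₚ.≤-refl (≤-from ≤0
        (solve 1 (λ q → (con 0ℚ :+ con 1ℚ) :+ (q :+ q :- con 1ℚ) := (q :+ q) :+ con 0ℚ) refl q)))
      (identity ℚₚ.≤-refl)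

  -- A doubling step stretches the gap r - q by two, unless q < ½ ≤ r, when
  -- t ⊕ t already reaches 1 above r.
  separate-0≤ : ∀ {ε} → 0ℚ ℚ.< ε → ∀ q r → 0ℚ ℚ.≤ q → ε ≡ r ℚ.- q → Separator (Above r) (Above q)
  separate-0≤ = doubling-induction _ 1ℚ base step
    where
    base : ∀ {ε} → 1ℚ ℚ.≤ ε → ∀ q r → 0ℚ ℚ.≤ q → ε ≡ r ℚ.- q → Separator (Above r) (Above q)
    base 1≤ε q r 0≤q refl =
      -- Here `r` is at least 1, so no value lies above it and the constant 0 separates.
      (λ _ → 0ᴵ) , (λ _ → 𝟎-open)
      , (λ t r∈ → contradiction (ℚₚ.<-≤-trans (𝕀.≤1 t r∈) 1≤r) (ℚₚ.<-irrefl refl))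
      , (λ t 0<0 → contradiction 0<0 (ℚₚ.<-irrefl refl))
      where
      1≤r : 1ℚ ℚ.≤ r
      1≤r = ≤-from (ℚₚ.+-mono-≤ 1≤ε 0≤q)
        (solve 2 (λ q r → r :+ (con 1ℚ :+ con 0ℚ) := con 1ℚ :+ ((r :- q) :+ q)) refl q r)

    step : ∀ {ε} → 0ℚ ℚ.< ε →
           (∀ q r → 0ℚ ℚ.≤ q → ε ℚ.+ ε ≡ r ℚ.- q → Separator (Above r) (Above q)) →
           ∀ q r → 0ℚ ℚ.≤ q → ε ≡ r ℚ.- q → Separator (Above r) (Above q)
    step _ ih q r 0≤q refl with r ℚ.+ r ℚₚ.<? 1ℚ | q ℚ.+ q ℚₚ.<? 1ℚ
    ... | yes 2r<1 | _ = double {Above r} {Above q} {Above (r ℚ.+ r)} {Above (q ℚ.+ q)}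
      (λ t r∈ → ⊕-diag⁺ t r∈ 2r<1) (λ t → ⊕-diag⁻ t)
      (ih (q ℚ.+ q) (r ℚ.+ r) (ℚₚ.+-mono-≤ 0≤q 0≤q)
        (solve 2 (λ q r → (r :- q) :+ (r :- q) := (r :+ r) :- (q :+ q)) refl q r))
    ... | no 2r≮1 | yes 2q<1 = double {Above r} {Above q} {IsOne} {Above (q ℚ.+ q)}
      (λ t r∈ → ⊕-diag-1 t r∈ (ℚₚ.≮⇒≥ 2r≮1)) (λ t → ⊕-diag⁻ t)
      -- After this doubling the upper values are all 1, and the remaining gap is 1 - (q + q).
      (separate-1 (<-from 2q<1 (solve 1 (λ p → (con 1ℚ :- p) :+ p := con 0ℚ :+ con 1ℚ) refl (q ℚ.+ q)))
        (q ℚ.+ q) refl)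
    ... | no 2r≮1 | no 2q≮1 = square {Above r} {Above q} {Above (r ℚ.+ r ℚ.- 1ℚ)} {Above (q ℚ.+ q ℚ.- 1ℚ)}
      (λ t → ⊙-diag⁺ t)
      (λ t h → ⊙-diag⁻ t h 0≤2q-1
        (ℚₚ.≤-reflexive (solve 1 (λ q → q :+ q := q :+ q :- con 1ℚ :+ con 1ℚ) refl q)))
      (ih (q ℚ.+ q ℚ.- 1ℚ) (r ℚ.+ r ℚ.- 1ℚ) 0≤2q-1
        (solve 2 (λ q r → (r :- q) :+ (r :- q) := (r :+ r :- con 1ℚ) :- (q :+ q :- con 1ℚ)) refl q r))
      where
      0≤2q-1 : 0ℚ ℚ.≤ q ℚ.+ q ℚ.- 1ℚ
      0≤2q-1 = ≤-from (ℚₚ.≮⇒≥ 2q≮1)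
        (solve 1 (λ p → (p :- con 1ℚ) :+ con 1ℚ := con 0ℚ :+ p) refl (q ℚ.+ q))

  separate : ∀ {q r} → q ℚ.< r → Separator (Above r) (Above q)
  separate {q} {r} q<r with q ℚₚ.<? 0ℚ
  -- Every value lies above a negative `q`.
  ... | yes q<0 = (λ _ → 1ᴵ) , (λ _ → 𝟏-open) , (λ _ _ → id) , (λ t _ → 𝕀.0≤ t q<0)
  ... | no q≮0  = separate-0≤
    (<-from q<r (solve 2 (λ q r → (r :- q) :+ q := con 0ℚ :+ r) refl q r)) q r (ℚₚ.≮⇒≥ q≮0) refl

-- Maximal families of sets without finite subcover

infix 4 _∈_ _∉_ _⊆_

_∈_ _∉_ : A → (A → Bool) → Set
x ∈ F = T (F x)
x ∉ F = ¬ x ∈ F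

_⊆_ : (A → Bool) → (A → Bool) → Set _
F ⊆ G = ∀ {x} → x ∈ F → x ∈ G

Listed : (A → Bool) → List A → Set _
Listed F = All (_∈ F)

Covers : List (Pred A 0ℓ) → Set _
Covers L = ∀ x → Any (λ S → S x) L

NonCovering : (Pred A 0ℓ → Bool) → Set _
NonCovering F = ∀ {L} → Listed F L → ¬ Covers L

module Tukey (em : Classical) (ext : FunExt) where

  -- Bool-valued subsets of A form a type at the level of A, on which
  -- mutual inclusion is equality.  Abstractness lets P be inferred
  -- from x ∈ ⟦ P ⟧.
  abstract

    ⟦_⟧ : Pred A p → A → Bool
    ⟦ P ⟧ x = isYes (em {P = P x})

    ∈⟦⟧⁺ : {P : Pred A p} {x : A} → P x → x ∈ ⟦ P ⟧
    ∈⟦⟧⁺ = fromWitness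

    ∈⟦⟧⁻ : {P : Pred A p} {x : A} → x ∈ ⟦ P ⟧ → P x
    ∈⟦⟧⁻ = toWitness

  stable : {P : Set p} → ¬ ¬ P → P
  stable = decidable-stable em

  ⊆-antisym : {F G : A → Bool} → F ⊆ G → G ⊆ F → F ≡ G
  ⊆-antisym {F = F} {G} F⊆G G⊆F = ext λ x → T-ext (F x) (G x) F⊆G G⊆F
    where
    T-ext : ∀ b c → (T b → T c) → (T c → T b) → b ≡ c
    T-ext false false _ _ = refl
    T-ext false true  _ g with () ← g tt
    T-ext true  false f _ with () ← f tt
    T-ext true  true  _ _ = refl

  -- The tower of stages and its fixed point

  module _ {a} {A : Set a} (F₀ : A → Bool) (grow : (A → Bool) → (A → Bool))
           (grow-⊇ : ∀ {F} → F ⊆ grow F) where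

    ⋃ : ((A → Bool) → Bool) → A → Bool
    ⋃ K = ⟦ (λ x → x ∈ F₀ ⊎ ∃ λ F → F ∈ K × x ∈ F) ⟧

    -- The Bourbaki–Witt tower over F₀, whose bottom F₀ is the union of
    -- the empty family of stages.
    data Stage : (A → Bool) → Set a where
      next : ∀ {F} → Stage F → Stage (grow F)
      sup  : ∀ K → (∀ {F} → F ∈ K → Stage F) → Stage (⋃ K)

    F₀⊆ : ∀ {F} → Stage F → F₀ ⊆ F
    F₀⊆ (next s)  = grow-⊇ ∘ F₀⊆ s
    F₀⊆ (sup K _) = ∈⟦⟧⁺ ∘ inj₁

    ⋃-least : ∀ {K G} → F₀ ⊆ G → (∀ {F} → F ∈ K → F ⊆ G) → ⋃ K ⊆ G
    ⋃-least F₀⊆G K⊆G x∈ with ∈⟦⟧⁻ x∈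
    ... | inj₁ x∈F₀          = F₀⊆G x∈F₀
    ... | inj₂ (F , F∈ , x∈F) = K⊆G F∈ x∈F

    ⋃-upper : ∀ {K F} → F ∈ K → F ⊆ ⋃ K
    ⋃-upper F∈ x∈ = ∈⟦⟧⁺ (inj₂ (_ , F∈ , x∈))

    -- The auxiliary notion of the Bourbaki-Witt argument: stages are first compared with extreme
    -- ones only, and then every stage is shown to be extreme.
    Extreme : (A → Bool) → Set a
    Extreme G = ∀ {F} → Stage F → F ⊆ G → ¬ G ⊆ F → grow F ⊆ G

    -- Induction on the stage `F`. Growing a proper subset of `G` stays inside `G` by extremeness,
    -- and growing `G` itself gives the second alternative. A union falls under the second if one of
    -- its members does.
    extreme-cmp : ∀ {F G} → Stage G → Extreme G → Stage F → F ⊆ G ⊎ grow G ⊆ F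
    extreme-cmp {G = G} sG eG (next {F} sF) with extreme-cmp sG eG sF
    ... | inj₂ G⁺⊆F = inj₂ (grow-⊇ ∘ G⁺⊆F)
    ... | inj₁ F⊆G with em {P = G ⊆ F}
    ...   | yes G⊆F = inj₂ (subst (λ H → grow G ⊆ grow H) (⊆-antisym G⊆F F⊆G) id)
    ...   | no G⊈F  = inj₁ (eG sF F⊆G G⊈F)
    extreme-cmp {G = G} sG eG (sup K s) with em {P = ∃ λ F → F ∈ K × grow G ⊆ F}
    ... | yes (F , F∈ , G⁺⊆F) = inj₂ (⋃-upper F∈ ∘ G⁺⊆F)
    ... | no ∄ = inj₁ (⋃-least (F₀⊆ sG) below)
      where
      below : ∀ {F} → F ∈ K → F ⊆ G
      below F∈ with extreme-cmp sG eG (s F∈)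
      ... | inj₁ F⊆G  = F⊆G
      ... | inj₂ G⁺⊆F = ⊥-elim (∄ (_ , F∈ , G⁺⊆F))

    extreme : ∀ {G} → Stage G → Extreme G
    extreme (next {G} sG) {F} sF F⊆G⁺ G⁺⊈F with extreme-cmp sG (extreme sG) sF
    ... | inj₂ G⁺⊆F = ⊥-elim (G⁺⊈F G⁺⊆F)
    ... | inj₁ F⊆G with em {P = G ⊆ F}
    ...   | yes G⊆F = subst (λ H → grow F ⊆ grow H) (⊆-antisym F⊆G G⊆F) id
    ...   | no G⊈F  = grow-⊇ ∘ extreme sG sF F⊆G G⊈F
    extreme (sup K s) {F} sF F⊆⋃ ⋃⊈F with em {P = ∃ λ G → G ∈ K × ¬ grow G ⊆ F}
    -- If `F` contained the growth of every member of `K`, it would contain their union.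
    ... | no ∄ = ⊥-elim (⋃⊈F
      (⋃-least (F₀⊆ sF) λ G∈ → stable (λ G⊈F → ∄ (_ , G∈ , λ G⁺⊆F → G⊈F (G⁺⊆F ∘ grow-⊇)))))
    ... | yes (G , G∈ , G⁺⊈F) with extreme-cmp (s G∈) (extreme (s G∈)) sF
    ...   | inj₂ G⁺⊆F = ⊥-elim (G⁺⊈F G⁺⊆F)
    ...   | inj₁ F⊆G with em {P = G ⊆ F}
    ...     | no G⊈F  = ⋃-upper G∈ ∘ extreme (s G∈) sF F⊆G G⊈F
    ...     | yes G⊆F with ⊆-antisym {F = F} {G = G} F⊆G G⊆F
    -- Now `F` is itself a member of `K`, hence extreme by induction, so the whole union can be
    -- compared with it.
    ...       | refl with extreme-cmp sF (extreme (s G∈)) (sup K s)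
    ...         | inj₁ ⋃⊆F = ⊥-elim (⋃⊈F ⋃⊆F)
    ...         | inj₂ F⁺⊆⋃ = F⁺⊆⋃

    chain : ∀ {F G} → Stage F → Stage G → F ⊆ G ⊎ G ⊆ F
    chain sF sG with extreme-cmp sG (extreme sG) sF
    ... | inj₁ F⊆G  = inj₁ F⊆G
    ... | inj₂ G⁺⊆F = inj₂ (G⁺⊆F ∘ grow-⊇)

    -- The union of all stages is a stage, and so is its growth, which is therefore one of the sets
    -- united. Being Bool-valued, the family of all stages is small enough for `sup`.
    fixed-stage : ∃ λ M → Stage M × grow M ⊆ M
    fixed-stage = ⋃ ⟦ Stage ⟧ , top , ⋃-upper (∈⟦⟧⁺ (next top))
      where top = sup ⟦ Stage ⟧ ∈⟦⟧⁻

    -- Finitely many members of a chain have a largest one. This carries `NonCovering`, a property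
    -- of finite character, over to unions; `F₀` is listed apart because `K` may be empty.
    listed-⋃ : ∀ {K} → (∀ {F} → F ∈ K → Stage F) → ∀ {L} → Listed (⋃ K) L →
               Listed F₀ L ⊎ ∃ λ F → F ∈ K × Listed F L
    listed-⋃ s [] = inj₁ []
    listed-⋃ s (x∈ ∷ L∈) with ∈⟦⟧⁻ x∈ | listed-⋃ s L∈
    ... | inj₁ x∈F₀ | inj₁ L∈F₀ = inj₁ (x∈F₀ ∷ L∈F₀)
    ... | inj₁ x∈F₀ | inj₂ (F , F∈ , L∈F) = inj₂ (F , F∈ , F₀⊆ (s F∈) x∈F₀ ∷ L∈F)
    ... | inj₂ (F , F∈ , x∈F) | inj₁ L∈F₀ = inj₂ (F , F∈ , x∈F ∷ All.map (F₀⊆ (s F∈)) L∈F₀)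
    ... | inj₂ (F , F∈ , x∈F) | inj₂ (G , G∈ , L∈G) with chain (s F∈) (s G∈)
    ...   | inj₁ F⊆G = inj₂ (G , G∈ , F⊆G x∈F ∷ L∈G)
    ...   | inj₂ G⊆F = inj₂ (F , F∈ , x∈F ∷ All.map G⊆F L∈G)

  -- Adjoining one set at a time

  module _ {ℓ} {X : Set ℓ} {N : Pred X 0ℓ → Bool} (N-nc : NonCovering N) where

    insert : Pred X 0ℓ → (Pred X 0ℓ → Bool) → Pred X 0ℓ → Bool
    insert S F = ⟦ (λ R → R ≡ S ⊎ R ∈ F) ⟧

    -- The clause `S ∉ F` makes every growth proper, so a fixed family has no extension.
    Extension : (Pred X 0ℓ → Bool) → Pred (Pred X 0ℓ) _
    Extension F S = S ∉ F × NonCovering (insert S F)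

    grow : (Pred X 0ℓ → Bool) → Pred X 0ℓ → Bool
    grow F with em {P = ∃ (Extension F)}
    ... | yes (S , _) = insert S F
    ... | no _        = F

    grow-⊇ : ∀ {F} → F ⊆ grow F
    grow-⊇ {F} with em {P = ∃ (Extension F)}
    ... | yes _ = ∈⟦⟧⁺ ∘ inj₂
    ... | no _  = id

    grow-nc : ∀ {F} → NonCovering F → NonCovering (grow F)
    grow-nc {F} nc with em {P = ∃ (Extension F)}
    ... | yes (_ , _ , nc′) = nc′
    ... | no _              = nc

    grow-fixed : ∀ {F} → grow F ⊆ F → ¬ ∃ (Extension F)
    grow-fixed {F} fixed with em {P = ∃ (Extension F)}
    ... | yes (S , S∉ , _) = contradiction (fixed (∈⟦⟧⁺ (inj₁ refl))) S∉
    ... | no ∄             = ∄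

    stage-nc : ∀ {F} → Stage N grow grow-⊇ F → NonCovering F
    stage-nc (next s)  = grow-nc (stage-nc s)
    stage-nc (sup K s) L∈ with listed-⋃ N grow grow-⊇ s L∈
    ... | inj₁ L∈N           = N-nc L∈N
    ... | inj₂ (F , F∈ , L∈F) = stage-nc (s F∈) L∈F

    -- Merging all copies of `S` into one at the head gives a cover the form that maximality speaks
    -- of.
    split-insert : ∀ {S F L} → Listed (insert S F) L →
                   ∃ λ L′ → Listed F L′ × (∀ {x} → Any (λ R → R x) L → Any (λ R → R x) (S ∷ L′))
    split-insert [] = [] , [] , λ ()
    split-insert (R∈ ∷ L∈) with ∈⟦⟧⁻ R∈ | split-insert L∈
    ... | inj₁ refl | L′ , L′∈ , cov = L′ , L′∈ , λ where
      (here x∈)  → here x∈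
      (there x∈) → cov x∈
    ... | inj₂ R∈F  | L′ , L′∈ , cov = _ ∷ L′ , R∈F ∷ L′∈ , λ where
      (here x∈)  → there (here x∈)
      (there x∈) → case cov x∈ of λ where
        (here x∈S)   → here x∈S
        (there x∈L′) → there (there x∈L′)

    maximal-nonCovering : ∃ λ M → N ⊆ M × NonCovering M ×
      (∀ {S} → S ∉ M → ∃ λ L → Listed M L × Covers (S ∷ L))
    maximal-nonCovering =
      let M , sM , fixed = fixed-stage N grow grow-⊇ in
      M , F₀⊆ N grow grow-⊇ sM , stage-nc sM , λ {S} S∉M → stable λ ∄ →
        grow-fixed {M} fixed (S , S∉M , λ L∈ cov →
          let L′ , L′∈ , cov′ = split-insert L∈ in ∄ (L′ , L′∈ , cov′ ∘ cov))

-- MV-topologies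

level : FuzzySet A → ℚ → Pred A 0ℓ
level f q x = ℝ.lower (value (f x)) q

⊕-comm-≤ : ∀ x y → x ⊕ y ≤ᴵ y ⊕ x
⊕-comm-≤ x y ((a , b , a∈ , b∈ , refl) , <1) = (b , a , b∈ , a∈ , ℚₚ.+-comm a b) , <1

x≤x⊕y : ∀ x y → x ≤ᴵ x ⊕ y
x≤x⊕y x y {q} q∈ =
  let r , q<r , r∈ = ℝ.rounded (value x) q∈ in
  (r , q ℚ.- r , r∈
  , 𝕀.0≤ y (<-from q<r (solve 2 (λ q r → con 0ℚ :+ q := (q :- r) :+ r) refl q r))
  , solve 2 (λ q r → q := r :+ (q :- r)) refl q r)
  , 𝕀.≤1 x q∈

y≤x⊕y : ∀ x y → y ≤ᴵ x ⊕ y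
y≤x⊕y x y y∈ = ⊕-comm-≤ y x (x≤x⊕y y x y∈)

-- This turns a finite sum equal to 1 into an ordinary finite cover by the sets where a summand is
-- positive.
⨁-positive : ∀ (αs : List (FuzzySet A)) {x} → level (⨁ αs) 0ℚ x → Any (λ α → level α 0ℚ x) αs
⨁-positive [] 0<0 = contradiction 0<0 (ℚₚ.<-irrefl refl)
⨁-positive (α ∷ αs) {x} ((a , b , a∈ , b∈ , 0≡a+b) , _) with ℚₚ.≤-total 0ℚ a
... | inj₁ 0≤a = here (downward-≤ (value (α x)) 0≤a a∈)
... | inj₂ a≤0 = there (⨁-positive αs (downward-≤ (value (⨁ αs x))
  (≤-from a≤0 (trans (ℚₚ.+-comm b a) (sym 0≡a+b))) b∈))

module Topology (em : Classical) (ext : FunExt) where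

  open Tukey em ext
  open DeMorgan em

  -- Joins range over a `Subset`, one level below topologies; excluded middle brings any predicate
  -- down to that level.
  Resize : Pred (FuzzySet A) ℓ′ → Subset A
  Resize P f = Lift _ (f ∈ ⟦ P ⟧)

  resize : {P : Pred (FuzzySet A) ℓ′} {f : FuzzySet A} → P f → Resize P f
  resize p = lift (∈⟦⟧⁺ p)

  unresize : {P : Pred (FuzzySet A) ℓ′} {f : FuzzySet A} → Resize P f → P f
  unresize (lift p) = ∈⟦⟧⁻ p

  -- If no member exceeded `q` at `x`, the constant `q` would be a smaller upper bound. It lies in
  -- [0,1] only for q ≥ 0; negative levels stand apart, as `Γ` may be empty.
  join-level : {Γ : Pred (FuzzySet A) ℓ′} {f : FuzzySet A} → IsJoin Γ f → ∀ {x q} →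
               level f q x → q ℚ.< 0ℚ ⊎ ∃ λ α → Γ α × level α q x
  join-level {Γ = Γ} {f} join {x} {q} q∈ with q ℚₚ.<? 0ℚ | em {P = ∃ λ α → Γ α × level α q x}
  ... | yes q<0 | _     = inj₁ q<0
  ... | no _    | yes ∃ = inj₂ ∃
  ... | no q≮0  | no ∄  = contradiction (IsJoin.least join x u below q∈) (ℚₚ.<-irrefl refl)
    where
    u : 𝕀
    u = record
      { value = fromℚ q
      ; 0≤    = λ p<0 → ℚₚ.<-≤-trans p<0 (ℚₚ.≮⇒≥ q≮0)
      ; ≤1    = λ p<q → ℚₚ.<-trans p<q (𝕀.≤1 (f x) q∈)
      }
    below : ∀ {α} → Γ α → α x ≤ᴵ u
    below {α} α∈ p∈ = ℝ.∈<∉ (value (α x)) p∈ λ q∈α → ∄ (α , α∈ , q∈α)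

  -- Otherwise each `y` has a level set around it whose preimage is in `M`. Separators that are 1 at
  -- `y` and positive only on that set form an open cover, and a finite subcover pulls back along
  -- `p` to a cover by members of `M`.
  limit-point : {X : Set ℓ} (𝒴 : MVSpace ℓ′) → IsCompact 𝒴 → {M : Pred X 0ℓ → Bool} → NonCovering M →
                (p : X → MVSpace.Carrier 𝒴) →
                ∃ λ y → ∀ {α q} → MVSpace.τ 𝒴 α → level α q y → level (α ∘ p) q ∉ M
  limit-point {X = X} 𝒴 compact {M} nc p = stable λ ∄ →
    let αs , αs∈ , ⨁≐𝟏 = compact (Resize Γ) (proj₁ ∘ unresize) (join ∄)
        L , L∈ , cov = levels αs∈
    in nc L∈ λ x → cov (⨁-positive αs (proj₂ (⨁≐𝟏 (p x)) (ℚₚ.positive⁻¹ 1ℚ)))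
    where
    open MVSpace 𝒴 renaming (Carrier to Y)
    open Separation isMVTopology

    Γ : LargeSubset Y
    Γ g = τ g × ∃₂ λ α q → level (α ∘ p) q ∈ M × ∀ y → level g 0ℚ y → level α q y

    NoLimit : Set _
    NoLimit = ¬ ∃ λ y → ∀ {α q} → τ α → level α q y → level (α ∘ p) q ∉ M

    witness : NoLimit → ∀ y → ∃₂ λ α q → τ α × level α q y × level (α ∘ p) q ∈ M
    witness ∄ y = stable λ ∄′ → ∄ (y , λ α∈ q∈ lvl∈ → ∄′ (_ , _ , α∈ , q∈ , lvl∈))

    join : NoLimit → IsJoin (Resize Γ) 𝟏
    join ∄ = record { upper = λ x {α} _ → 𝕀.≤1 (α x) ; least = least }
      where
      least : ∀ y (u : 𝕀) → (∀ {g} → Resize Γ g → g y ≤ᴵ u) → 1ᴵ ≤ᴵ u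
      least y u bound =
        let α , q , α∈ , q∈ , lvl∈ = witness ∄ y
            r , q<r , r∈ = ℝ.rounded (value (α y)) q∈
            φ , φ-open , one , pos = separate q<r
        in λ p<1 → bound (resize (φ-open α∈ , α , q , lvl∈ , λ z → pos (α z))) (one (α y) r∈ p<1)

    levels : ∀ {αs} → All (Resize Γ) αs → ∃ λ L → Listed M L ×
             ∀ {x} → Any (λ g → level g 0ℚ (p x)) αs → Any (λ S → S x) L
    levels [] = [] , [] , λ ()
    levels (g∈ ∷ gs∈) =
      let _ , α , q , lvl∈ , sub = unresize g∈
          L , L∈ , cov = levels gs∈
      in level (α ∘ p) q ∷ L , lvl∈ ∷ L∈ , λ where
        (here 0∈)  → here (sub _ 0∈)
        (there 0∈) → there (cov 0∈)

  -- Clopens and zero-dimensionality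

  module _ (𝒴 : MVSpace ℓ) where

    open MVSpace 𝒴 renaming (Carrier to Y)
    open IsMVTopology isMVTopology

    ∨-open : ∀ {f g} → τ f → τ g → τ (λ x → f x ∨ g x)
    ∨-open {f} {g} f∈ g∈ = ⋁-open (λ h → h ≡ f ⊎ h ≡ g)
      (λ { (inj₁ refl) → f∈ ; (inj₂ refl) → g∈ }) record
      { upper = λ { x (inj₁ refl) → inj₁ ; x (inj₂ refl) → inj₂ }
      ; least = λ x u bound → [ bound (inj₁ refl) , bound (inj₂ refl) ]′
      }

    clopen-𝟎 : Clopen 𝒴 𝟎
    clopen-𝟎 = 𝟎-open , 𝟏 , 𝟏-open , λ x → 𝕀.0≤ (1ᴵ *) , λ q∈ →
      let r , r≮1 , q+r<1 = complement⁻ 1ᴿ q∈ in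
      <-from (ℚₚ.<-≤-trans q+r<1 (ℚₚ.≮⇒≥ r≮1)) (ℚₚ.+-identityˡ _)

    clopen-𝟏 : Clopen 𝒴 𝟏
    clopen-𝟏 = 𝟏-open , 𝟎 , 𝟎-open , λ x →
      (λ {q} q<1 → complement⁺ 0ᴿ (ℚₚ.<-irrefl refl) (subst (ℚ._< 1ℚ) (sym (ℚₚ.+-identityʳ q)) q<1))
      , 𝕀.≤1 (0ᴵ *)

    clopen-⊕ : ∀ {f g} → Clopen 𝒴 f → Clopen 𝒴 g → Clopen 𝒴 (f ⊕̇ g)
    clopen-⊕ {f} {g} (f∈ , o , o∈ , f≐) (g∈ , o′ , o′∈ , g≐) =
      ⊕-open f∈ g∈ , o ⊙̇ o′ , ⊙-open o∈ o′∈ , λ x →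
      proj₁ (*-⊕ (o x) (o′ x)) ∘ ⊕-mono (f x) (o x *) (g x) (o′ x *) (proj₁ (f≐ x)) (proj₁ (g≐ x))
      , ⊕-mono (o x *) (f x) (o′ x *) (g x) (proj₂ (f≐ x)) (proj₂ (g≐ x)) ∘ proj₂ (*-⊕ (o x) (o′ x))

    clopen-⊙ : ∀ {f g} → Clopen 𝒴 f → Clopen 𝒴 g → Clopen 𝒴 (f ⊙̇ g)
    clopen-⊙ {f} {g} (f∈ , o , o∈ , f≐) (g∈ , o′ , o′∈ , g≐) =
      ⊙-open f∈ g∈ , o ⊕̇ o′ , ⊕-open o∈ o′∈ , λ x →
      proj₁ (*-⊙ (o x) (o′ x)) ∘ ⊙-mono (f x) (o x *) (g x) (o′ x *) (proj₁ (f≐ x)) (proj₁ (g≐ x))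
      , ⊙-mono (o x *) (f x) (o′ x *) (g x) (proj₂ (f≐ x)) (proj₂ (g≐ x)) ∘ proj₂ (*-⊙ (o x) (o′ x))

    clopen-∧ : ∀ {f g} → Clopen 𝒴 f → Clopen 𝒴 g → Clopen 𝒴 (f ∧̇ g)
    clopen-∧ {f} {g} (f∈ , o , o∈ , f≐) (g∈ , o′ , o′∈ , g≐) =
      ∧-open f∈ g∈ , (λ x → o x ∨ o′ x) , ∨-open o∈ o′∈ , λ x →
      proj₁ (*-∧ (o x) (o′ x)) ∘ ∧-mono (f x) (o x *) (g x) (o′ x *) (proj₁ (f≐ x)) (proj₁ (g≐ x))
      , ∧-mono (o x *) (f x) (o′ x *) (g x) (proj₂ (f≐ x)) (proj₂ (g≐ x)) ∘ proj₂ (*-∧ (o x) (o′ x))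

    -- Being the join of the clopens below, stated level by level: in this form it passes through
    -- each operation by splitting the rational witness.
    Approximable : FuzzySet Y → Set _
    Approximable f = ∀ {x q} → level f q x →
      ∃ λ β → Clopen 𝒴 β × (∀ y → β y ≤ᴵ f y) × level β q x

    approximable-0 : ∀ {f : FuzzySet Y} {x : Y} {q} → q ℚ.< 0ℚ →
      ∃ λ β → Clopen 𝒴 β × (∀ y → β y ≤ᴵ f y) × level β q x
    approximable-0 {f} q<0 = 𝟎 , clopen-𝟎 , (λ y → 𝕀.0≤ (f y)) , q<0

    approximable-⋁ : ∀ {Γ : Subset Y} {f} → IsJoin Γ f → (∀ {α} → Γ α → Approximable α) → Approximable f
    approximable-⋁ {f = f} join approx q∈ with join-level join q∈
    ... | inj₁ q<0 = approximable-0 {f} q<0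
    ... | inj₂ (α , α∈ , q∈α) =
      let β , β-clopen , β≤α , q∈β = approx α∈ q∈α in
      β , β-clopen , (λ y → IsJoin.upper join y α∈ ∘ β≤α y) , q∈β

    approximable-∧ : ∀ {f g} → Approximable f → Approximable g → Approximable (f ∧̇ g)
    approximable-∧ {f} {g} approx-f approx-g (q∈f , q∈g) =
      let β , β-clopen , β≤f , q∈β = approx-f q∈f
          γ , γ-clopen , γ≤g , q∈γ = approx-g q∈g
      in β ∧̇ γ , clopen-∧ β-clopen γ-clopen
         , (λ y → ∧-mono (β y) (f y) (γ y) (g y) (β≤f y) (γ≤g y)) , q∈β , q∈γ

    approximable-⊕ : ∀ {f g} → Approximable f → Approximable g → Approximable (f ⊕̇ g)
    approximable-⊕ {f} {g} approx-f approx-g ((a , b , a∈f , b∈g , eq) , q<1) =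
      let β , β-clopen , β≤f , a∈β = approx-f a∈f
          γ , γ-clopen , γ≤g , b∈γ = approx-g b∈g
      in β ⊕̇ γ , clopen-⊕ β-clopen γ-clopen
         , (λ y → ⊕-mono (β y) (f y) (γ y) (g y) (β≤f y) (γ≤g y))
         , (a , b , a∈β , b∈γ , eq) , q<1

    approximable-⊙ : ∀ {f g} → Approximable f → Approximable g → Approximable (f ⊙̇ g)
    approximable-⊙ {f} {g} approx-f approx-g (inj₂ q<0) = approximable-0 {f ⊙̇ g} q<0
    approximable-⊙ {f} {g} approx-f approx-g (inj₁ (p , c , (a , b , a∈f , b∈g , eq) , c∈ , eq′)) =
      let β , β-clopen , β≤f , a∈β = approx-f a∈f
          γ , γ-clopen , γ≤g , b∈γ = approx-g b∈g
      in β ⊙̇ γ , clopen-⊙ β-clopen γ-clopen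
         , (λ y → ⊙-mono (β y) (f y) (γ y) (g y) (β≤f y) (γ≤g y))
         , inj₁ (p , c , (a , b , a∈β , b∈γ , eq) , c∈ , eq′)

    approximable⇒zeroDimensional : (∀ {f} → τ f → Approximable f) → IsZeroDimensional 𝒴
    approximable⇒zeroDimensional approx = Clopen 𝒴 , (proj₁ , base) , id
      where
      base : ∀ {o} → τ o → ∃ λ (Γ : Subset Y) → (∀ {α} → Γ α → Clopen 𝒴 α) × IsJoin Γ o
      base {o} o∈ = Resize (λ β → Clopen 𝒴 β × ∀ y → β y ≤ᴵ o y) , proj₁ ∘ unresize , record
        { upper = λ x β∈ → proj₂ (unresize β∈) x
        ; least = λ x u bound q∈ →
            let β , β-clopen , β≤o , q∈β = approx o∈ q∈ in
            bound (resize (β-clopen , β≤o)) q∈β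
        }

  -- Each `α` is taken twice, since `α ⊕ α` is 1 wherever `α` exceeds ½; the other summands can only
  -- increase the sum.
  doubled : {X : Set ℓ} {Γ : Subset X} {L : List (Pred X 0ℓ)} →
    All (λ S → ∃ λ α → Γ α × S ≡ level α ½) L →
    ∃ λ αs → All Γ αs × ∀ {x} → Any (λ S → S x) L → 1ᴵ ≤ᴵ ⨁ αs x
  doubled [] = [] , [] , λ ()
  doubled ((α , α∈ , refl) ∷ L∈) =
    let αs , αs∈ , one = doubled L∈ in
    α ∷ α ∷ αs , α∈ ∷ α∈ ∷ αs∈ , λ {x} → λ where
      (here ½∈) p<1 → ⊕-mono (α x) (α x) (α x) (α x ⊕ ⨁ αs x) id (x≤x⊕y (α x) (⨁ αs x))
        (⊕-diag-1 (α x) ½∈ ℚₚ.≤-refl p<1)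
      (there cov) p<1 → y≤x⊕y (α x) (α x ⊕ ⨁ αs x) (y≤x⊕y (α x) (⨁ αs x) (one cov p<1))

  -- The product space

  module _ {I : Set ℓ} (𝒳 : I → MVSpace ℓ) where

    private module 𝒳 i = MVSpace (𝒳 i)

    module _ {M : Pred (ΠCarrier 𝒳) 0ℓ → Bool} (nc : NonCovering M)
             (maximal : ∀ {S} → S ∉ M → ∃ λ L → Listed M L × Covers (S ∷ L))
             (x : ΠCarrier 𝒳)
             (limit : ∀ i {α q} → 𝒳.τ i α → level α q (x i) → level (α ∘ π 𝒳 i) q ∉ M) where

      -- By maximality, the complement of M is a filter.
      ∉-∩ : ∀ {R S U} → R ∉ M → S ∉ M → (∀ {y} → R y → S y → U y) → U ∉ M
      ∉-∩ {R} {S} {U} R∉ S∉ sub U∈ =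
        let K , K∈ , covR = maximal R∉
            L , L∈ , covS = maximal S∉
        in nc (U∈ ∷ Allₚ.++⁺ K∈ L∈) (cover covR covS)
        where
        cover : ∀ {K L} → Covers (R ∷ K) → Covers (S ∷ L) → Covers (U ∷ K ++ L)
        cover {K} covR covS y with covR y | covS y
        ... | there y∈K | _         = there (Anyₚ.++⁺ˡ y∈K)
        ... | here _    | there y∈L = there (Anyₚ.++⁺ʳ K y∈L)
        ... | here y∈R  | here y∈S  = here (sub y∈R y∈S)

      ∉-⊇ : ∀ {S U} → S ∉ M → (∀ {y} → S y → U y) → U ∉ M
      ∉-⊇ S∉ sub = ∉-∩ S∉ S∉ (λ y∈ _ → sub y∈)

      ∉-whole : ∀ {U} → (∀ y → U y) → U ∉ M
      ∉-whole all U∈ = nc (U∈ ∷ []) (λ y → here (all y))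

      -- The rationals witnessing the level at `x` serve at all points: for q = a + b < 1, `f ⊕̇ g`
      -- exceeds `q` wherever `f` exceeds `a` and `g` exceeds `b`. The sets outside `M` are closed
      -- under such intersections and under supersets.
      limit-generated : ∀ {f q} → Generated (productSubbase 𝒳) f → level f q x → level f q ∉ M
      limit-generated (subbase (i , α , α∈ , refl)) q∈ = limit i α∈ q∈
      limit-generated 𝟎-gen q<0 = ∉-whole λ _ → q<0
      limit-generated 𝟏-gen q<1 = ∉-whole λ _ → q<1
      limit-generated {f} (⋁-gen Γ Γ⊆ join) q∈ with join-level join q∈
      ... | inj₁ q<0            = ∉-whole λ y → 𝕀.0≤ (f y) q<0
      ... | inj₂ (α , α∈ , q∈α) = ∉-⊇ (limit-generated (Γ⊆ α∈) q∈α) (IsJoin.upper join _ α∈)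
      limit-generated (⊙-gen {f} {g} f∈ g∈) (inj₁ (p , c , (a , b , a∈ , b∈ , eq) , c∈ , eq′)) =
        ∉-∩ (limit-generated f∈ a∈) (limit-generated g∈ b∈)
          λ a∈f b∈g → inj₁ (p , c , (a , b , a∈f , b∈g , eq) , c∈ , eq′)
      limit-generated (⊙-gen _ _) (inj₂ q<0) = ∉-whole λ _ → inj₂ q<0
      limit-generated (⊕-gen f∈ g∈) ((a , b , a∈ , b∈ , eq) , q<1) =
        ∉-∩ (limit-generated f∈ a∈) (limit-generated g∈ b∈)
          λ a∈f b∈g → (a , b , a∈f , b∈g , eq) , q<1
      limit-generated (∧-gen f∈ g∈) (q∈f , q∈g) =
        ∉-∩ (limit-generated f∈ q∈f) (limit-generated g∈ q∈g) _,_

    product-compact : (∀ i → IsCompact (𝒳 i)) → IsCompact (Product 𝒳)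
    product-compact compact Γ Γ⊆ join = stable λ ∄ →
      let M , N⊆M , nc , maximal = maximal-nonCovering (N-nc ∄)
          -- The simultaneous choice of limit points rests on `stable`, which yields an actual point
          -- in each factor.
          x = λ i → proj₁ (limit-point (𝒳 i) (compact i) nc (π 𝒳 i))
          limit = λ i {α} {q} → proj₂ (limit-point (𝒳 i) (compact i) nc (π 𝒳 i)) {α} {q}
          α , α∈ , ½∈ = half-covers x
      in limit-generated nc maximal x limit (Γ⊆ α∈) ½∈ (N⊆M (∈⟦⟧⁺ (α , α∈ , refl)))
      where
      N : Pred (ΠCarrier 𝒳) 0ℓ → Bool
      N = ⟦ (λ S → ∃ λ α → Γ α × S ≡ level α ½) ⟧

      N-nc : ¬ (∃ λ αs → All Γ αs × ⨁ αs ≐ 𝟏) → NonCovering N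
      N-nc ∄ L∈ cov =
        let αs , αs∈ , one = doubled (All.map ∈⟦⟧⁻ L∈) in
        ∄ (αs , αs∈ , λ x → 𝕀.≤1 (⨁ αs x) , one (cov x))

      half-covers : ∀ x → ∃ λ α → Γ α × level α ½ x
      half-covers x with join-level join {x} {½} (from-yes (½ ℚₚ.<? 1ℚ))
      ... | inj₁ ½<0 = contradiction ½<0 (ℚₚ.<-asym (ℚₚ.positive⁻¹ ½))
      ... | inj₂ found = found

    product-hausdorff : (∀ i → IsHausdorff (𝒳 i)) → IsHausdorff (Product 𝒳)
    product-hausdorff hausdorff {x} {y} x≢y =
      -- By function extensionality, distinct points differ in some coordinate.
      let i , xᵢ≢yᵢ = stable λ ∄ → x≢y (ext λ i → stable λ xᵢ≢yᵢ → ∄ (i , xᵢ≢yᵢ))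
          o₁ , o₂ , o₁∈ , o₂∈ , eq₁ , eq₂ , disjoint = hausdorff i xᵢ≢yᵢ
      in o₁ ∘ π 𝒳 i , o₂ ∘ π 𝒳 i
         , subbase (i , o₁ , o₁∈ , refl) , subbase (i , o₂ , o₂∈ , refl)
         , eq₁ , eq₂ , λ z → disjoint (z i)

    product-zeroDimensional : (∀ i → IsZeroDimensional (𝒳 i)) → IsZeroDimensional (Product 𝒳)
    product-zeroDimensional zeroDim = approximable⇒zeroDimensional (Product 𝒳) approx
      where
      clopen-π : ∀ i {α} → Clopen (𝒳 i) α → Clopen (Product 𝒳) (α ∘ π 𝒳 i)
      clopen-π i (α∈ , o , o∈ , α≐) =
        subbase (i , _ , α∈ , refl) , o ∘ π 𝒳 i , subbase (i , o , o∈ , refl) , λ x → α≐ (x i)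

      approx : ∀ {f} → Generated (productSubbase 𝒳) f → Approximable (Product 𝒳) f
      approx (subbase (i , α , α∈ , refl)) q∈ =
        -- Some basic clopen of the factor, below `α`, already exceeds `q` at the coordinate, and
        -- its pullback is clopen.
        let B , (B⊆τ , base) , B⊆Clopen = zeroDim i
            Γ , Γ⊆B , join = base α∈
        in [ approximable-0 (Product 𝒳) {α ∘ π 𝒳 i}
           , (λ (β , β∈ , q∈β) → β ∘ π 𝒳 i , clopen-π i (B⊆Clopen (Γ⊆B β∈))
               , (λ x → IsJoin.upper join (x i) β∈) , q∈β) ]′
           (join-level join q∈)
      approx 𝟎-gen q<0 = 𝟎 , clopen-𝟎 (Product 𝒳) , (λ _ → id) , q<0
      approx 𝟏-gen q<1 = 𝟏 , clopen-𝟏 (Product 𝒳) , (λ _ → id) , q<1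
      approx (⋁-gen Γ Γ⊆ join) = approximable-⋁ (Product 𝒳) join (λ α∈ → approx (Γ⊆ α∈))
      approx (⊙-gen {f} {g} f∈ g∈) = approximable-⊙ (Product 𝒳) {f} {g} (approx f∈) (approx g∈)
      approx (⊕-gen {f} {g} f∈ g∈) = approximable-⊕ (Product 𝒳) {f} {g} (approx f∈) (approx g∈)
      approx (∧-gen {f} {g} f∈ g∈) = approximable-∧ (Product 𝒳) {f} {g} (approx f∈) (approx g∈)

corollary6p3 : Classical → FunExt → ∀ {ℓ} {I : Set ℓ} (𝒳 : I → MVSpace ℓ) →
    (∀ i → IsStone (𝒳 i)) → IsStone (Product 𝒳)
corollary6p3 em ext 𝒳 stone = record
  { compact         = product-compact 𝒳 (IsStone.compact ∘ stone)
  ; hausdorff       = product-hausdorff 𝒳 (IsStone.hausdorff ∘ stone)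
  ; zeroDimensional = product-zeroDimensional 𝒳 (IsStone.zeroDimensional ∘ stone)
  }
  where open Topology em ext
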